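{- Let $n\ge 3$ be odd. The subgroup $\mathbf{E}_S$ of the $n\times n\times n$ Rubik's Cube group $\mathbf{G}$ consisting of the elements that fix every sticker not lying on a single edge cubie and leave every single edge orientation equal to $0$ (when applied to the solved cube) is isomorphic to the alternating group $\mathcal{A}_{12}$ (via its action on the 12 single-edge positions).
   Context: The $n\times n\times n$ Rubik's Cube has faces U, D, F, B, R, L, each an $n\times n$ grid of facelets carrying stickers ($6n^2$ in total); in the solved state each face is monochromatic with six distinct colors. For $1\le k\le\lfloor n/2\rfloor$, $F_k,B_k,R_k,L_k,U_k,D_k$ denote clockwise (seen from the named face) $90^\circ$ rotations of the $k$-th $n\times n\times 1$ slice counted from the named face. $\mathbf{G}$ is the subgroup of the symmetric group on the facelets generated by the facelet permutations induced by these moves. Along each of the 12 edges of the big cube lie edge cubies (two stickers) at positions $2,\dots,n-1$; for odd $n$ the one at position $(n+1)/2$ is a single edge (12 in total). Single edge orientation: one of the two facelets of each single-edge position is fixed as reference facelet (a fixed choice for which all single edges have orientation $0$ in the solved state); a single edge cubie has orientation $0$ iff its sticker that lay on a reference facelet in the solved state lies on a reference facelet, and $1$ otherwise. -}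

module Defs where

open import Data.Nat using (ℕ; zero; suc; _∸_; _/_; _<ᵇ_; _≡ᵇ_)
open import Data.Nat.Divisibility using (_∣_)
open import Data.Nat.ListAction using (sum)
open import Data.Bool using (Bool; true; false; _∧_; _∨_; not; if_then_else_; T)
open import Data.Fin using (Fin; toℕ; opposite; #_)
open import Data.List using (List; []; _∷_; map; allFin)
open import Data.Product using (_×_)
open import Relation.Binary.PropositionalEquality using (_≡_)
open import Relation.Nullary using (¬_)
open import Function using (_∘_; id)
open import Data.Fin.Permutation using (Permutation′; _⟨$⟩ʳ_)

-- Geometry.  The n×n×n cube occupies the interior {1..n}^3 of the grid
-- {0..n+1}^3.  A facelet (sticker position) is represented by the grid
-- point just outside its cubie: exactly one coordinate is 0 or n+1
-- (the face it lies on), the other two are interior.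
-- Axes: R = +x, L = -x, U = +y, D = -y, F = +z, B = -z (right-handed).

record Pt (n : ℕ) : Set where
  constructor pt
  field
    x y z : Fin (suc (suc n))
open Pt public

isBd : (n : ℕ) → Fin (suc (suc n)) → Bool
isBd n i = (toℕ i ≡ᵇ 0) ∨ (toℕ i ≡ᵇ suc n)

Facelet : (n : ℕ) → Pt n → Set
Facelet n (pt a b c) =
  T ((isBd n a ∧ not (isBd n b) ∧ not (isBd n c))
   ∨ (not (isBd n a) ∧ isBd n b ∧ not (isBd n c))
   ∨ (not (isBd n a) ∧ not (isBd n b) ∧ isBd n c))

-- quarter turns, clockwise as seen from the + face of the axis
rX rY rZ : {n : ℕ} → Pt n → Pt n
rX (pt a b c) = pt a c (opposite b)
rY (pt a b c) = pt (opposite c) b a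
rZ (pt a b c) = pt b (opposite a) c

data Face : Set where
  U D F B R L : Face

data Dir : Set where
  cw ccw : Dir

record Move : Set where
  constructor mv
  field
    face  : Face
    layer : ℕ
    dir   : Dir
open Move public

-- clockwise quarter turn as seen from the named face
turn : {n : ℕ} → Face → Pt n → Pt n
turn R = rX
turn L = rX ∘ rX ∘ rX
turn U = rY
turn D = rY ∘ rY ∘ rY
turn F = rZ
turn B = rZ ∘ rZ ∘ rZ

-- is grid coordinate i in the k-th slice from the + face / - face
-- (for k = 1 this includes the stickers on the face itself)
plusLayer minusLayer : (n k : ℕ) → Fin (suc (suc n)) → Bool
plusLayer  n k i = (toℕ i ≡ᵇ (suc n ∸ k)) ∨ ((k ≡ᵇ 1) ∧ (toℕ i ≡ᵇ suc n))
minusLayer n k i = (toℕ i ≡ᵇ k) ∨ ((k ≡ᵇ 1) ∧ (toℕ i ≡ᵇ 0))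

inSlice : (n : ℕ) → Face → ℕ → Pt n → Bool
inSlice n R k p = plusLayer  n k (x p)
inSlice n L k p = minusLayer n k (x p)
inSlice n U k p = plusLayer  n k (y p)
inSlice n D k p = minusLayer n k (y p)
inSlice n F k p = plusLayer  n k (z p)
inSlice n B k p = minusLayer n k (z p)

applyMove : (n : ℕ) → Move → Pt n → Pt n
applyMove n (mv f k cw)  p = if inSlice n f k p then turn f p else p
applyMove n (mv f k ccw) p =
  if inSlice n f k p then turn f (turn f (turn f p)) else p

ValidMove : ℕ → Move → Set
ValidMove n m = T ((0 <ᵇ layer m) ∧ ((layer m <ᵇ suc (n / 2))))

-- a word in the generators; its permutation of the facelets
-- (elements of G = permutations eval n w for words w of valid moves)
eval : (n : ℕ) → List Move → Pt n → Pt n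
eval n []      = id
eval n (m ∷ w) = applyMove n m ∘ eval n w

-- Single edges (n odd).  Cubie coordinate of a grid coordinate:
clamp : (n : ℕ) → Fin (suc (suc n)) → ℕ
clamp n i = if toℕ i ≡ᵇ 0 then 1 else (if toℕ i ≡ᵇ suc n then n else toℕ i)

isMid isExt hi : (n : ℕ) → Fin (suc (suc n)) → Bool
isMid n i = clamp n i ≡ᵇ suc (n / 2)
isExt n i = (clamp n i ≡ᵇ 1) ∨ (clamp n i ≡ᵇ n)
hi    n i = clamp n i ≡ᵇ n

SingleEdge : (n : ℕ) → Pt n → Set
SingleEdge n p = Facelet n p × T (
     (isMid n (x p) ∧ isExt n (y p) ∧ isExt n (z p))
   ∨ (isExt n (x p) ∧ isMid n (y p) ∧ isExt n (z p))
   ∨ (isExt n (x p) ∧ isExt n (y p) ∧ isMid n (z p)))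

-- numbering of the 12 single edge positions: middle axis and the
-- sides (low/high) of the two remaining axes
code : ℕ → Bool → Bool → Fin 12
code 0 false false = # 0
code 0 false true  = # 1
code 0 true  false = # 2
code 0 true  true  = # 3
code 1 false false = # 4
code 1 false true  = # 5
code 1 true  false = # 6
code 1 true  true  = # 7
code _ false false = # 8
code _ false true  = # 9
code _ true  false = # 10
code _ true  true  = # 11

edgeIdx : (n : ℕ) → Pt n → Fin 12
edgeIdx n (pt a b c) =
  if isMid n a then code 0 (hi n b) (hi n c)
  else (if isMid n b then code 1 (hi n a) (hi n c)
  else code 2 (hi n a) (hi n b))

-- which of the two facelets of its single edge a facelet is:
-- true iff its face lies along the second of the two non-middle axes
second : (n : ℕ) → Pt n → Bool
second n (pt a b c) =
  if isMid n a then isBd n c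
  else (if isMid n b then isBd n c else isBd n b)

-- A choice of reference facelet for each single-edge position
-- (ch e = which of the two facelets of edge e is the reference one).
IsRef : (n : ℕ) → (Fin 12 → Bool) → Pt n → Set
IsRef n ch p = second n p ≡ ch (edgeIdx n p)

-- E_S (w.r.t. the reference choice ch): fixes every sticker not on a
-- single edge, and every single edge keeps orientation 0, i.e. the
-- sticker on a reference facelet is moved to a reference facelet.
InES : (n : ℕ) → (Fin 12 → Bool) → List Move → Set
InES n ch w =
  (∀ p → Facelet n p → ¬ SingleEdge n p → eval n w p ≡ p)
  × (∀ p → SingleEdge n p → IsRef n ch p → IsRef n ch (eval n w p))

Induces : (n : ℕ) → List Move → (Fin 12 → Fin 12) → Set
Induces n w σ = ∀ p → SingleEdge n p → edgeIdx n (eval n w p) ≡ σ (edgeIdx n p)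

inversions : {k : ℕ} → (Fin k → Fin k) → ℕ
inversions {k} f =
  sum (map (λ i → sum (map (λ j →
        if (toℕ i <ᵇ toℕ j) ∧ (toℕ (f j) <ᵇ toℕ (f i)) then 1 else 0)
      (allFin k))) (allFin k))

IsEven : {k : ℕ} → Permutation′ k → Set
IsEven σ = 2 ∣ inversions (σ ⟨$⟩ʳ_)

{-# OPTIONS --safe #-}
module Submission where

-- A quarter turn of an outermost slice is a 4-cycle on the single edges and a 4-cycle on the
-- corners, and the deeper slices move neither.  Hence single edges and corners are always permuted
-- with the same parity, and an element of E_S, which fixes the corners, acts evenly; it is
-- determined by its action on positions because the orientations single out the image facelet.
--
-- Conversely, take two words in face turns, each cycling three whole edges (single edges together
-- with their wings), with one edge in common.  Conjugating the second by a turn of all inner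
-- slices other than the middle one moves its wings away from those of the first but leaves its
-- action on single edges unchanged, so the commutator is a pure 3-cycle of single edges.  Its
-- conjugates by face turns give the 3-cycles (i i+1 i+2) in every orientation, and these generate
-- the alternating group.
--
-- A coordinate enters only through being 0, 1, (n+1)/2, n, n+1 or something else, so these facts
-- about slices and facelets reduce to finite computations that are uniform in n.

open import Defs
open import Algebra.Properties.CommutativeSemigroup using (x∙yz≈y∙xz)
open import Data.Bool using (Bool; true; false; if_then_else_; _∧_; _∨_; not; T; _xor_)
open import Data.Bool.Properties using (T?; T-≡; T-∧; ∨-identityʳ; not-involutive; not-distribˡ-xor; not-distribʳ-xor; xor-assoc; xor-same; xor-identityʳ; xor-annihilates-not) renaming (_≟_ to _≟ᵇ_)
open import Data.Fin using (Fin; zero; suc; toℕ; inject₁; opposite; fromℕ<; #_)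
open import Data.Fin.Induction using (<-weakInduction)
open import Data.Fin.Patterns
open import Data.Fin.Permutation as Perm using (Permutation′; permutation; _∘ₚ_; _⟨$⟩ʳ_)
open import Data.Fin.Permutation.Components using (transpose)
open import Data.Fin.Permutation.Transposition.List using (TranspositionList; decompose; eval-decompose) renaming (eval to evalᵗ)
open import Data.Fin.Properties using (_≟_; all?; toℕ-injective; toℕ-fromℕ<; toℕ≤pred[n]; opposite-prop; opposite-involutive) renaming (suc-injective to sucᶠ-injective)
open import Data.List using (List; []; _∷_; _++_; map; length; concatMap; allFin)
open import Data.List.Properties using (map-tabulate; map-cong; length-++)
open import Data.List.Relation.Unary.All using (All; []; _∷_)
open import Data.List.Relation.Unary.All.Properties using (++⁺)
open import Data.Nat using (ℕ; zero; suc; _+_; _*_; _∸_; _/_; _%_; _≤_; _<_; _≡ᵇ_; _<ᵇ_; s≤s; z≤n; s≤s⁻¹; _≤?_) renaming (_≟_ to _≟ⁿ_)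
open import Data.Nat.DivMod using (m≡m%n+[m/n]*n)
open import Data.Nat.Divisibility using (_∣_; divides; ∣-refl; ∣m∣n⇒∣m+n; _∣0)
open import Data.Nat.ListAction using (sum)
open import Data.Nat.Properties hiding (_≟_; _≤?_)
open import Data.Product using (_×_; _,_; proj₁; proj₂; ∃; Σ)
open import Data.Sum using (_⊎_; inj₁; inj₂)
open import Data.Unit using (⊤; tt)
open import Function using (_∘_; id; Equivalence)
open import Function.Definitions using (Injective)
open import Relation.Binary.PropositionalEquality
open import Relation.Nullary using (¬_; Dec; yes; no; does; contradiction; ¬?)
open import Relation.Nullary.Decidable using (map′; _×-dec_; _⊎-dec_; _→-dec_; True; toWitness)

-- Finite statements decided by evaluation

decide : {A : Set} (a? : Dec A) {t : True a?} → A
decide a? {t} = toWitness t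

∀ᵇ? : {P : Bool → Set} → (∀ b → Dec (P b)) → Dec (∀ b → P b)
∀ᵇ? P? = map′ (λ { (f , t) false → f ; (f , t) true → t }) (λ h → h false , h true)
  (P? false ×-dec P? true)

∀ᶠ? : {P : Face → Set} → (∀ f → Dec (P f)) → Dec (∀ f → P f)
∀ᶠ? P? = map′
  (λ { (u , d , f , b , r , l) → λ { U → u ; D → d ; F → f ; B → b ; R → r ; L → l } })
  (λ h → h U , h D , h F , h B , h R , h L)
  (P? U ×-dec P? D ×-dec P? F ×-dec P? B ×-dec P? R ×-dec P? L)

-- Inversions and adjacent transpositions

odd : ℕ → Bool
odd zero    = false
odd (suc n) = not (odd n)

2∣⇒¬odd : ∀ {n} → 2 ∣ n → odd n ≡ false
2∣⇒¬odd (divides q refl) = even q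
  where
  even : ∀ q → odd (q * 2) ≡ false
  even zero    = refl
  even (suc q) = trans (not-involutive _) (even q)

¬odd⇒2∣ : ∀ n → odd n ≡ false → 2 ∣ n
¬odd⇒2∣ zero          _  = 2 ∣0
¬odd⇒2∣ (suc (suc n)) eq = ∣m∣n⇒∣m+n ∣-refl (¬odd⇒2∣ n (trans (sym (not-involutive _)) eq))

bit : Bool → ℕ
bit b = if b then 1 else 0

count : ∀ {k} → (Fin k → Bool) → ℕ
count {zero}  g = 0
count {suc k} g = bit (g zero) + count (g ∘ suc)

-- Values lie in `ℕ` rather than `Fin k`, so that the tail `f ∘ suc` is a function of the same kind
-- and recursion on `k` is possible.
inv : ∀ {k} → (Fin k → ℕ) → ℕ
inv {zero}  f = 0
inv {suc k} f = count (λ j → f (suc j) <ᵇ f zero) + inv (f ∘ suc)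

sum-allFin : ∀ {k} (h : Fin (suc k) → ℕ) → sum (map h (allFin (suc k))) ≡ h zero + sum (map (h ∘ suc) (allFin k))
sum-allFin {k} h = cong (λ l → h zero + sum l) (trans (map-tabulate suc h) (sym (map-tabulate id (h ∘ suc))))

sum-bits : ∀ {k} (g : Fin k → Bool) → sum (map (bit ∘ g) (allFin k)) ≡ count g
sum-bits {zero}  g = refl
sum-bits {suc k} g = trans (sum-allFin (bit ∘ g)) (cong (bit (g zero) +_) (sum-bits (g ∘ suc)))

-- The row of `zero` collects the inversions with the first entry. In every other row the column of
-- `zero` contributes 0, since `toℕ i <ᵇ 0` computes to `false`.
double-sum≡inv : ∀ {k} (f : Fin k → ℕ) →
  sum (map (λ i → sum (map (λ j → bit ((toℕ i <ᵇ toℕ j) ∧ (f j <ᵇ f i))) (allFin k))) (allFin k)) ≡ inv f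
double-sum≡inv {zero}  f = refl
double-sum≡inv {suc k} f = trans (sum-allFin row) (cong₂ _+_
  (trans (sum-allFin (cell zero)) (sum-bits (λ j → f (suc j) <ᵇ f zero)))
  (trans (cong sum (map-cong (λ i → sum-allFin (cell (suc i))) (allFin k))) (double-sum≡inv (f ∘ suc))))
  where
  cell : Fin (suc k) → Fin (suc k) → ℕ
  cell i j = bit ((toℕ i <ᵇ toℕ j) ∧ (f j <ᵇ f i))
  row : Fin (suc k) → ℕ
  row i = sum (map (cell i) (allFin (suc k)))

inversions≡inv : ∀ {k} (f : Fin k → Fin k) → inversions f ≡ inv (toℕ ∘ f)
inversions≡inv f = double-sum≡inv (toℕ ∘ f)

-- The transposition of `inject₁ i` and `suc i`, given by recursion so that it computes along with
-- `count` and `inv`.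
adj : ∀ {k} → Fin k → Fin (suc k) → Fin (suc k)
adj zero    zero          = suc zero
adj zero    (suc zero)    = zero
adj zero    (suc (suc j)) = suc (suc j)
adj (suc i) zero          = zero
adj (suc i) (suc j)       = suc (adj i j)

adj-involutive : ∀ {k} (i : Fin k) j → adj i (adj i j) ≡ j
adj-involutive zero    zero          = refl
adj-involutive zero    (suc zero)    = refl
adj-involutive zero    (suc (suc j)) = refl
adj-involutive (suc i) zero          = refl
adj-involutive (suc i) (suc j)       = cong suc (adj-involutive i j)

adj-injective : ∀ {k} (i : Fin k) → Injective _≡_ _≡_ (adj i)
adj-injective i {a} {b} eq = trans (sym (adj-involutive i a)) (trans (cong (adj i) eq) (adj-involutive i b))

count-adj : ∀ {k} (i : Fin k) g → count (g ∘ adj i) ≡ count g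
count-adj zero    g = x∙yz≈y∙xz +-commutativeSemigroup (bit (g 1F)) (bit (g 0F)) (count (λ j → g (suc (suc j))))
count-adj (suc i) g = cong (bit (g zero) +_) (count-adj i (g ∘ suc))

<ᵇ-swap : ∀ a b → a ≢ b → (a <ᵇ b) ≡ not (b <ᵇ a)
<ᵇ-swap zero    zero    a≢b = contradiction refl a≢b
<ᵇ-swap zero    (suc b) a≢b = refl
<ᵇ-swap (suc a) zero    a≢b = refl
<ᵇ-swap (suc a) (suc b) a≢b = <ᵇ-swap a b (a≢b ∘ cong suc)

odd-+ : ∀ m n → odd (m + n) ≡ (odd m xor odd n)
odd-+ zero    n = refl
odd-+ (suc m) n = trans (cong not (odd-+ m n)) (not-distribˡ-xor (odd m) (odd n))

-- Here `b` tells whether the first two values form an inversion, `c₀` and `c₁` count the later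
-- values below the first and below the second, and `r` counts the inversions among the later ones.
-- Exchanging the first two values toggles `b` and swaps `c₀` with `c₁`.
odd-exchange : ∀ b c₀ c₁ r → odd (bit (not b) + c₁ + (c₀ + r)) ≡ not (odd (bit b + c₀ + (c₁ + r)))
odd-exchange true  c₀ c₁ r = trans (cong odd (x∙yz≈y∙xz +-commutativeSemigroup c₁ c₀ r)) (sym (not-involutive _))
odd-exchange false c₀ c₁ r = cong (not ∘ odd) (x∙yz≈y∙xz +-commutativeSemigroup c₁ c₀ r)

-- Only the exchanged pair changes its relative order. The induction can pass over the first entry
-- because the count against it is merely reindexed, by `count-adj`.
odd-inv-adj : ∀ {k} (i : Fin k) (f : Fin (suc k) → ℕ) → f (inject₁ i) ≢ f (suc i) →
  odd (inv (f ∘ adj i)) ≡ not (odd (inv f))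
odd-inv-adj {suc _} zero f f₀≢f₁ rewrite <ᵇ-swap (f 0F) (f 1F) f₀≢f₁ =
  odd-exchange (f 1F <ᵇ f 0F) (count (λ j → f (suc (suc j)) <ᵇ f 0F))
    (count (λ j → f (suc (suc j)) <ᵇ f 1F)) (inv (λ j → f (suc (suc j))))
odd-inv-adj (suc i) f fᵢ≢fᵢ₊₁
  rewrite count-adj i (λ j → f (suc j) <ᵇ f zero) =
  begin
  odd (c + inv (f ∘ suc ∘ adj i))       ≡⟨ odd-+ c _ ⟩
  odd c xor odd (inv (f ∘ suc ∘ adj i)) ≡⟨ cong (odd c xor_) (odd-inv-adj i (f ∘ suc) fᵢ≢fᵢ₊₁) ⟩
  odd c xor not (odd (inv (f ∘ suc)))   ≡⟨ not-distribʳ-xor (odd c) _ ⟨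
  not (odd c xor odd (inv (f ∘ suc)))   ≡⟨ cong not (odd-+ c _) ⟨
  not (odd (c + inv (f ∘ suc)))         ∎
  where
  open ≡-Reasoning
  c = count (λ j → f (suc j) <ᵇ f zero)

-- `_∘ₚ_` composes in diagrammatic order, so the head of a word acts last, as in `run` and `eval`.
adjs : ∀ {k} → List (Fin k) → Permutation′ (suc k)
adjs []      = Perm.id
adjs (i ∷ u) = adjs u ∘ₚ permutation (adj i) (adj i) (adj-involutive i) (adj-involutive i)

adjs-++ : ∀ {k} (u v : List (Fin k)) j → adjs (u ++ v) ⟨$⟩ʳ j ≡ adjs u ⟨$⟩ʳ (adjs v ⟨$⟩ʳ j)
adjs-++ []      v j = refl
adjs-++ (i ∷ u) v j = cong (adj i) (adjs-++ u v j)

inject₁≢suc : ∀ {k} (i : Fin k) → inject₁ i ≢ suc i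
inject₁≢suc (suc i) eq = inject₁≢suc i (sucᶠ-injective eq)

-- Stated for every injective `f` because the induction replaces `f` by `f ∘ adj i`.
odd-inv-adjs : ∀ {k} (u : List (Fin k)) {f : Fin (suc k) → ℕ} → Injective _≡_ _≡_ f →
  odd (inv (f ∘ (adjs u ⟨$⟩ʳ_))) ≡ (odd (length u) xor odd (inv f))
odd-inv-adjs []              f-inj = refl
odd-inv-adjs (i ∷ u) {f = f} f-inj = trans
  (odd-inv-adjs u (adj-injective i ∘ f-inj))
  (trans (cong (odd (length u) xor_) (odd-inv-adj i f (inject₁≢suc i ∘ f-inj)))
    (trans (sym (not-distribʳ-xor (odd (length u)) (odd (inv f))))
      (not-distribˡ-xor (odd (length u)) (odd (inv f)))))

count-false : ∀ k → count {k} (λ _ → false) ≡ 0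
count-false zero    = refl
count-false (suc k) = count-false k

inv-suc : ∀ {k} (f : Fin k → ℕ) → inv (suc ∘ f) ≡ inv f
inv-suc {zero}  f = refl
inv-suc {suc k} f = cong (count (λ j → f (suc j) <ᵇ f zero) +_) (inv-suc (f ∘ suc))

inv-toℕ : ∀ k → inv {k} toℕ ≡ 0
inv-toℕ zero    = refl
inv-toℕ (suc k) = cong₂ _+_ (count-false k) (trans (inv-suc (toℕ {k})) (inv-toℕ k))

odd-inversions-adjs : ∀ {k} (u : List (Fin k)) → odd (inversions (adjs u ⟨$⟩ʳ_)) ≡ odd (length u)
odd-inversions-adjs {k} u = begin
  odd (inversions (adjs u ⟨$⟩ʳ_))    ≡⟨ cong odd (inversions≡inv (adjs u ⟨$⟩ʳ_)) ⟩
  odd (inv (toℕ ∘ (adjs u ⟨$⟩ʳ_)))   ≡⟨ odd-inv-adjs u (toℕ-injective {suc k}) ⟩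
  (odd (length u) xor odd (inv {suc k} toℕ)) ≡⟨ cong (λ m → odd (length u) xor odd m) (inv-toℕ (suc k)) ⟩
  (odd (length u) xor false)         ≡⟨ xor-identityʳ _ ⟩
  odd (length u)                     ∎
  where open ≡-Reasoning

-- A word for the transposition of `zero` and `suc j`. The recursive case conjugates a shifted
-- transposition, which moves 1 instead of 0, by the exchange of 0 and 1.
swap₀ : ∀ {k} → Fin k → List (Fin k)
swap₀ zero    = zero ∷ []
swap₀ (suc j) = zero ∷ map suc (swap₀ j) ++ zero ∷ []

swapWord : ∀ {k} → Fin (suc k) → Fin (suc k) → List (Fin k)
swapWord         zero    zero    = []
swapWord         zero    (suc j) = swap₀ j
swapWord         (suc i) zero    = swap₀ i
swapWord {suc _} (suc i) (suc j) = map suc (swapWord i j)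

-- The proofs by decision are abstract because normalising them is expensive.
abstract
  adjs-swapWord : ∀ (i j k : Fin 12) → adjs (swapWord i j) ⟨$⟩ʳ k ≡ transpose i j k
  adjs-swapWord = decide (all? λ i → all? λ j → all? λ k → (adjs {11} (swapWord i j) ⟨$⟩ʳ k) ≟ transpose i j k)

wordOf : TranspositionList 12 → List (Fin 11)
wordOf []             = []
wordOf ((i , j) ∷ xs) = wordOf xs ++ swapWord i j

adjs-wordOf : ∀ xs k → adjs (wordOf xs) ⟨$⟩ʳ k ≡ evalᵗ xs ⟨$⟩ʳ k
adjs-wordOf []             k = refl
adjs-wordOf ((i , j) ∷ xs) k = trans (adjs-++ (wordOf xs) (swapWord i j) k)
  (trans (adjs-wordOf xs _) (cong (evalᵗ xs ⟨$⟩ʳ_) (adjs-swapWord i j k)))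

abstract
  adjs-surjective : ∀ (σ : Permutation′ 12) → ∃ λ u → ∀ k → adjs u ⟨$⟩ʳ k ≡ σ ⟨$⟩ʳ k
  adjs-surjective σ = wordOf (decompose σ) ,
    λ k → trans (adjs-wordOf (decompose σ) k) (eval-decompose σ k)

inversions-cong : ∀ {k} {f g : Fin k → Fin k} → (∀ i → f i ≡ g i) → inversions f ≡ inversions g
inversions-cong {k} {f} {g} eq = cong sum (map-cong (λ i → cong sum (map-cong (λ j →
  cong₂ (λ a b → bit ((toℕ i <ᵇ toℕ j) ∧ (toℕ a <ᵇ toℕ b))) (eq j) (eq i)) (allFin k))) (allFin k))

even⇒¬odd : ∀ {k} (σ : Permutation′ (suc k)) (u : List (Fin k)) →
  (∀ j → adjs u ⟨$⟩ʳ j ≡ σ ⟨$⟩ʳ j) → IsEven σ → odd (length u) ≡ false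
even⇒¬odd σ u eq even = trans (sym (odd-inversions-adjs u))
  (trans (cong odd (inversions-cong eq)) (2∣⇒¬odd even))

adjs-even : ∀ {k} (u : List (Fin k)) → odd (length u) ≡ false → IsEven (adjs u)
adjs-even u eq = ¬odd⇒2∣ _ (trans (odd-inversions-adjs u) eq)

-- Comparison with the empty word; it is applied to the corners, which an element of `E_S` fixes.
adjs-id⇒¬odd : ∀ {k} (u : List (Fin k)) → (∀ j → adjs u ⟨$⟩ʳ j ≡ j) → odd (length u) ≡ false
adjs-id⇒¬odd {k} u eq = trans (sym (odd-inversions-adjs u))
  (trans (cong odd (inversions-cong eq)) (odd-inversions-adjs {k} []))

-- Symbolic facelets

-- Symbolic grid coordinates: sp lists 0, 1, (n+1)/2, n, n+1, and vr i b is the i-th coordinate of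
-- a fixed point, mirrored if b, in case it is none of these.
data Coord : Set where
  sp : Fin 5 → Coord
  vr : Fin 3 → Bool → Coord

pattern out₋ = sp 0F
pattern ext₋ = sp 1F
pattern mid  = sp 2F
pattern ext₊ = sp 3F
pattern out₊ = sp 4F

_≟ᶜ_ : (c d : Coord) → Dec (c ≡ d)
sp i   ≟ᶜ sp j   = map′ (cong sp) (λ { refl → refl }) (i ≟ j)
sp _   ≟ᶜ vr _ _ = no λ ()
vr _ _ ≟ᶜ sp _   = no λ ()
vr i a ≟ᶜ vr j b = map′ (λ { (refl , refl) → refl }) (λ { refl → refl , refl }) (i ≟ j ×-dec a ≟ᵇ b)

mirror : Coord → Coord
mirror out₋ = out₊
mirror ext₋ = ext₊
mirror mid  = mid
mirror ext₊ = ext₋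
mirror out₊ = out₋
mirror (vr i b) = vr i (not b)

record SPt : Set where
  constructor spt
  field
    sx sy sz : Coord
open SPt

_≟ˢ_ : (s t : SPt) → Dec (s ≡ t)
spt a b c ≟ˢ spt a′ b′ c′ =
  map′ (λ { (refl , refl , refl) → refl }) (λ { refl → refl , refl , refl }) (a ≟ᶜ a′ ×-dec (b ≟ᶜ b′ ×-dec c ≟ᶜ c′))

rXˢ rYˢ rZˢ : SPt → SPt
rXˢ (spt a b c) = spt a c (mirror b)
rYˢ (spt a b c) = spt (mirror c) b a
rZˢ (spt a b c) = spt b (mirror a) c

turnˢ : Face → SPt → SPt
turnˢ R = rXˢ
turnˢ L = rXˢ ∘ rXˢ ∘ rXˢ
turnˢ U = rYˢ
turnˢ D = rYˢ ∘ rYˢ ∘ rYˢ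
turnˢ F = rZˢ
turnˢ B = rZˢ ∘ rZˢ ∘ rZˢ

-- `top` and `bottom` include the coordinates just outside the cube, because the first slice carries
-- the stickers of its face.
top bottom isVar isBdˢ isMidˢ isExtˢ hiˢ : Coord → Bool
top ext₊ = true
top out₊ = true
top _    = false
bottom ext₋ = true
bottom out₋ = true
bottom _    = false
isVar (sp _)   = false
isVar (vr _ _) = true
isBdˢ out₋ = true
isBdˢ out₊ = true
isBdˢ _    = false
isMidˢ mid = true
isMidˢ _   = false
isExtˢ c = bottom c ∨ top c
hiˢ = top

onFace : Face → SPt → Bool
onFace R s = top    (sx s)
onFace L s = bottom (sx s)
onFace U s = top    (sy s)
onFace D s = bottom (sy s)
onFace F s = top    (sz s)
onFace B s = bottom (sz s)

-- inner turns all slices orthogonal to the x-axis except the two outermost and the middle one.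
data Gen : Set where
  outer : Face → Dir → Gen
  inner : Gen

∀ᵍ? : {P : Gen → Set} → (∀ g → Dec (P g)) → Dec (∀ g → P g)
∀ᵍ? P? = map′
  (λ { (o , i) → λ { (outer f cw) → proj₁ (o f) ; (outer f ccw) → proj₂ (o f) ; inner → i } })
  (λ h → (λ f → h (outer f cw) , h (outer f ccw)) , h inner)
  (∀ᶠ? (λ f → P? (outer f cw) ×-dec P? (outer f ccw)) ×-dec P? inner)

step : Gen → SPt → SPt
step (outer f cw)  s = if onFace f s then turnˢ f s else s
step (outer f ccw) s = if onFace f s then turnˢ f (turnˢ f (turnˢ f s)) else s
step inner         s = if isVar (sx s) then rXˢ s else s

run : List Gen → SPt → SPt
run []      = id
run (g ∷ w) = step g ∘ run w

faceletˢ edgeShape edgeˢ : SPt → Bool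
faceletˢ (spt a b c) =
     (isBdˢ a ∧ not (isBdˢ b) ∧ not (isBdˢ c))
   ∨ (not (isBdˢ a) ∧ isBdˢ b ∧ not (isBdˢ c))
   ∨ (not (isBdˢ a) ∧ not (isBdˢ b) ∧ isBdˢ c)
edgeShape (spt a b c) =
     (isMidˢ a ∧ isExtˢ b ∧ isExtˢ c)
   ∨ (isExtˢ a ∧ isMidˢ b ∧ isExtˢ c)
   ∨ (isExtˢ a ∧ isExtˢ b ∧ isMidˢ c)
edgeˢ s = faceletˢ s ∧ edgeShape s

edgeIdxˢ : SPt → Fin 12
edgeIdxˢ (spt a b c) =
  if isMidˢ a then code 0 (hiˢ b) (hiˢ c)
  else (if isMidˢ b then code 1 (hiˢ a) (hiˢ c)
  else code 2 (hiˢ a) (hiˢ b))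

secondˢ : SPt → Bool
secondˢ (spt a b c) =
  if isMidˢ a then isBdˢ c
  else (if isMidˢ b then isBdˢ c else isBdˢ b)

-- The first argument chooses the high or low side, the second tells whether the facelet faces along
-- this axis and so lies just outside.
side : Bool → Bool → Coord
side false false = ext₋
side false true  = out₋
side true  false = ext₊
side true  true  = out₊

-- Inverse to the pair `edgeIdxˢ`, `secondˢ` on single edges, as `sticker-idx` and `edge-point`
-- confirm.
sticker : Fin 12 → Bool → SPt
sticker 0F  s = spt mid (side false (not s)) (side false s)
sticker 1F  s = spt mid (side false (not s)) (side true  s)
sticker 2F  s = spt mid (side true  (not s)) (side false s)
sticker 3F  s = spt mid (side true  (not s)) (side true  s)
sticker 4F  s = spt (side false (not s)) mid (side false s)
sticker 5F  s = spt (side false (not s)) mid (side true  s)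
sticker 6F  s = spt (side true  (not s)) mid (side false s)
sticker 7F  s = spt (side true  (not s)) mid (side true  s)
sticker 8F  s = spt (side false (not s)) (side false s) mid
sticker 9F  s = spt (side false (not s)) (side true  s) mid
sticker (suc (suc 8F)) s = spt (side true  (not s)) (side false s) mid
sticker (suc (suc 9F)) s = spt (side true  (not s)) (side true  s) mid

sym6 : Fin 3 → Fin 6 → Coord
sym6 i 0F = out₋
sym6 i 1F = ext₋
sym6 i 2F = mid
sym6 i 3F = ext₊
sym6 i 4F = out₊
sym6 i 5F = vr i false

-- Every point of the cube has this form, with itself as the fixed point referred to by vr.
point : Fin 6 → Fin 6 → Fin 6 → SPt
point i j k = spt (sym6 0F i) (sym6 1F j) (sym6 2F k)

pattern U⁺ = outer U cw
pattern U⁻ = outer U ccw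
pattern D⁺ = outer D cw
pattern D⁻ = outer D ccw
pattern F⁺ = outer F cw
pattern F⁻ = outer F ccw
pattern B⁺ = outer B cw
pattern B⁻ = outer B ccw
pattern R⁺ = outer R cw
pattern R⁻ = outer R ccw
pattern L⁺ = outer L cw
pattern L⁻ = outer L ccw

inverseGen : Gen → List Gen
inverseGen (outer f cw)  = outer f ccw ∷ []
inverseGen (outer f ccw) = outer f cw ∷ []
inverseGen inner         = inner ∷ inner ∷ inner ∷ []

inverse : List Gen → List Gen
inverse []      = []
inverse (g ∷ w) = inverse w ++ inverseGen g

conjugate commutator : List Gen → List Gen → List Gen
conjugate  v w = v ++ w ++ inverse v
commutator v w = v ++ w ++ inverse v ++ inverse w

-- Variants of the usual edge 3-cycle F² U L R⁻¹ F² L⁻¹ R U F² of the 3×3×3 cube; on the n×n×n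
-- cube each of them cycles three whole edges, wings included, and turns the centres of U and F by
-- 180°.  Words act from right to left.
lines₁ lines₂ : List Gen
lines₁ = F⁺ ∷ F⁺ ∷ U⁺ ∷ R⁺ ∷ L⁻ ∷ F⁺ ∷ F⁺ ∷ R⁻ ∷ L⁺ ∷ U⁺ ∷ F⁺ ∷ F⁺ ∷ []
lines₂ = U⁺ ∷ U⁺ ∷ F⁺ ∷ L⁺ ∷ R⁻ ∷ U⁺ ∷ U⁺ ∷ L⁻ ∷ R⁺ ∷ F⁺ ∷ U⁺ ∷ U⁺ ∷ []

-- Two 3-cycles with exactly one common point have a 3-cycle as commutator. That no other sticker
-- moves is confirmed by evaluation, for the conjugates in use, in `cycle3-fixes`.
pure3 : List Gen
pure3 = commutator lines₁ (conjugate (inner ∷ []) lines₂)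

-- Found by breadth-first search: carries the three single edges cycled by pure3, in cyclic order,
-- to the positions i, i+1, i+2, matching facelet s of i with facelets s xor a and s xor b of the
-- other two.
toTriple : Fin 10 → Bool → Bool → List Gen
toTriple 0F false false = U⁺ ∷ B⁺ ∷ B⁺ ∷ F⁺ ∷ U⁺ ∷ []
toTriple 0F false true  = B⁻ ∷ L⁻ ∷ B⁻ ∷ F⁺ ∷ U⁺ ∷ []
toTriple 0F true  false = B⁺ ∷ R⁺ ∷ F⁺ ∷ U⁻ ∷ L⁻ ∷ []
toTriple 0F true  true  = U⁺ ∷ B⁺ ∷ F⁺ ∷ U⁺ ∷ L⁻ ∷ []
toTriple 1F false false = F⁻ ∷ R⁻ ∷ U⁻ ∷ L⁺ ∷ R⁺ ∷ []
toTriple 1F false true  = F⁺ ∷ U⁺ ∷ U⁺ ∷ L⁺ ∷ []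
toTriple 1F true  false = U⁻ ∷ R⁺ ∷ F⁺ ∷ []
toTriple 1F true  true  = F⁻ ∷ L⁺ ∷ U⁺ ∷ []
toTriple 2F false false = U⁻ ∷ L⁻ ∷ F⁻ ∷ R⁺ ∷ []
toTriple 2F false true  = F⁻ ∷ L⁻ ∷ U⁺ ∷ []
toTriple 2F true  false = U⁻ ∷ R⁺ ∷ U⁺ ∷ L⁻ ∷ []
toTriple 2F true  true  = L⁻ ∷ U⁺ ∷ R⁺ ∷ []
toTriple 3F false false = L⁺ ∷ D⁻ ∷ F⁺ ∷ U⁺ ∷ L⁺ ∷ []
toTriple 3F false true  = L⁺ ∷ L⁺ ∷ F⁻ ∷ L⁻ ∷ []
toTriple 3F true  false = B⁺ ∷ U⁻ ∷ F⁻ ∷ R⁺ ∷ []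
toTriple 3F true  true  = B⁻ ∷ D⁻ ∷ L⁺ ∷ F⁻ ∷ []
toTriple 4F false false = F⁻ ∷ U⁺ ∷ R⁺ ∷ U⁻ ∷ L⁻ ∷ []
toTriple 4F false true  = L⁻ ∷ D⁻ ∷ R⁺ ∷ R⁺ ∷ F⁺ ∷ []
toTriple 4F true  false = F⁺ ∷ R⁺ ∷ F⁺ ∷ U⁻ ∷ L⁻ ∷ []
toTriple 4F true  true  = F⁺ ∷ R⁺ ∷ R⁺ ∷ F⁺ ∷ L⁻ ∷ []
toTriple 5F false false = B⁻ ∷ R⁻ ∷ U⁻ ∷ L⁺ ∷ R⁺ ∷ []
toTriple 5F false true  = R⁻ ∷ F⁻ ∷ U⁻ ∷ R⁻ ∷ []
toTriple 5F true  false = R⁻ ∷ U⁻ ∷ L⁺ ∷ R⁻ ∷ []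
toTriple 5F true  true  = B⁻ ∷ L⁺ ∷ U⁺ ∷ []
toTriple 6F false false = L⁺ ∷ R⁻ ∷ D⁺ ∷ F⁻ ∷ L⁺ ∷ R⁺ ∷ []
toTriple 6F false true  = B⁻ ∷ L⁺ ∷ L⁺ ∷ U⁺ ∷ []
toTriple 6F true  false = L⁺ ∷ R⁻ ∷ F⁻ ∷ U⁻ ∷ R⁻ ∷ []
toTriple 6F true  true  = R⁻ ∷ U⁻ ∷ L⁺ ∷ L⁺ ∷ R⁻ ∷ []
toTriple 7F false false = U⁺ ∷ F⁺ ∷ L⁺ ∷ F⁻ ∷ []
toTriple 7F false true  = F⁺ ∷ L⁺ ∷ F⁻ ∷ L⁻ ∷ []
toTriple 7F true  false = L⁺ ∷ B⁺ ∷ L⁺ ∷ U⁺ ∷ []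
toTriple 7F true  true  = U⁻ ∷ L⁺ ∷ L⁺ ∷ U⁺ ∷ []
toTriple 8F false false = D⁻ ∷ B⁺ ∷ B⁺ ∷ F⁺ ∷ U⁺ ∷ []
toTriple 8F false true  = L⁺ ∷ L⁺ ∷ R⁻ ∷ D⁻ ∷ F⁺ ∷ []
toTriple 8F true  false = L⁺ ∷ F⁻ ∷ L⁻ ∷ R⁻ ∷ []
toTriple 8F true  true  = L⁻ ∷ F⁺ ∷ R⁻ ∷ F⁺ ∷ L⁻ ∷ []
toTriple 9F false false = D⁺ ∷ F⁺ ∷ L⁻ ∷ U⁻ ∷ L⁺ ∷ []
toTriple 9F false true  = D⁺ ∷ R⁺ ∷ F⁺ ∷ []
toTriple 9F true  false = L⁻ ∷ U⁻ ∷ L⁺ ∷ R⁻ ∷ []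
toTriple 9F true  true  = R⁺ ∷ B⁻ ∷ U⁺ ∷ []

-- Pure 3-cycles of single edges

cycle3 : Fin 10 → Bool → Bool → List Gen
cycle3 i a b = conjugate (toTriple i a b) pure3

abstract
  -- Each of the 40 words is evaluated on the 216 symbolic points, which stand for all points of the
  -- cubes of every size.
  cycle3-fixes : ∀ i a b j k l → T (faceletˢ (point j k l)) → ¬ T (edgeˢ (point j k l)) →
    run (cycle3 i a b) (point j k l) ≡ point j k l
  cycle3-fixes = decide (all? λ i → ∀ᵇ? λ a → ∀ᵇ? λ b → all? λ j → all? λ k → all? λ l →
    T? (faceletˢ (point j k l)) →-dec (¬? (T? (edgeˢ (point j k l))) →-dec
      (run (cycle3 i a b) (point j k l) ≟ˢ point j k l)))

-- The 3-cycle sending `first₃` to `second₃`, `second₃` to `third₃` and `third₃` to `first₃`,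
-- factored so that it combines with words in adjacent transpositions.
rot3 : Fin 10 → Fin 12 → Fin 12
rot3 i = adj (inject₁ i) ∘ adj (suc i)

first₃ second₃ third₃ : Fin 10 → Fin 12
first₃  i = inject₁ (inject₁ i)
second₃ i = suc (inject₁ i)
third₃  i = suc (suc i)

-- Facelet `s` of the first edge is matched with facelet `s xor offset i a b j` of edge `j`. Outside
-- the triple `rot3 i` fixes `j`, and the two offsets in `cycle3-sticker` cancel.
offset : Fin 10 → Bool → Bool → Fin 12 → Bool
offset i a b j = if does (j ≟ second₃ i) then a else if does (j ≟ third₃ i) then b else false

abstract
  cycle3-sticker : ∀ i a b j s → run (cycle3 i a b) (sticker j s) ≡
    sticker (rot3 i j) (s xor (offset i a b j xor offset i a b (rot3 i j)))
  cycle3-sticker = decide (all? λ i → ∀ᵇ? λ a → ∀ᵇ? λ b → all? λ j → ∀ᵇ? λ s → _ ≟ˢ _)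

  offset-values : ∀ i a b →
    offset i a b (first₃ i) ≡ false × offset i a b (second₃ i) ≡ a × offset i a b (third₃ i) ≡ b
  offset-values = decide (all? λ i → ∀ᵇ? λ a → ∀ᵇ? λ b → (_ ≟ᵇ _) ×-dec (_ ≟ᵇ _) ×-dec (_ ≟ᵇ _))

InTriple : Fin 10 → Fin 12 → Set
InTriple i j = j ≡ first₃ i ⊎ j ≡ second₃ i ⊎ j ≡ third₃ i

inTriple? : ∀ i j → Dec (InTriple i j)
inTriple? i j = (j ≟ first₃ i) ⊎-dec (j ≟ second₃ i) ⊎-dec (j ≟ third₃ i)

abstract
  rot3-support : ∀ i j → rot3 i j ≡ j ⊎ (InTriple i j × InTriple i (rot3 i j))
  rot3-support = decide (all? λ i → all? λ j →
    (rot3 i j ≟ j) ⊎-dec (inTriple? i j ×-dec inTriple? i (rot3 i j)))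

  -- The square of a 3-cycle is its inverse, which has the same two factors in the opposite order.
  rot3-inverse : ∀ i j → rot3 i (rot3 i j) ≡ adj (suc i) (adj (inject₁ i) j)
  rot3-inverse = decide (all? λ i → all? λ j → _ ≟ _)

-- Action of the generators on single edges and corners

cycle4 : ∀ {k} (a b c d : Fin (suc k)) → List (Fin k)
cycle4 a b c d = swapWord a b ++ swapWord b c ++ swapWord c d

dirCycle : ∀ {k} → Dir → (a b c d : Fin (suc k)) → List (Fin k)
dirCycle cw  a b c d = cycle4 a b c d
dirCycle ccw a b c d = cycle4 d c b a

-- Positions are numbered by `code` and listed in the order in which the clockwise turn visits them;
-- `cycle4` sends each of its arguments to the next one. The table is verified in `step-sticker`.
edgeWord : Gen → List (Fin 11)
edgeWord (outer U d) = dirCycle d (# 2) (# 11) (# 3) (# 9)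
edgeWord (outer D d) = dirCycle d (# 0) (# 8) (# 1) (# 10)
edgeWord (outer F d) = dirCycle d (# 1) (# 5) (# 3) (# 7)
edgeWord (outer B d) = dirCycle d (# 0) (# 6) (# 2) (# 4)
edgeWord (outer R d) = dirCycle d (# 6) (# 10) (# 7) (# 11)
edgeWord (outer L d) = dirCycle d (# 4) (# 9) (# 5) (# 8)
edgeWord inner       = []

cornerWord : Gen → List (Fin 7)
cornerWord (outer U d) = dirCycle d (# 2) (# 6) (# 7) (# 3)
cornerWord (outer D d) = dirCycle d (# 0) (# 1) (# 5) (# 4)
cornerWord (outer F d) = dirCycle d (# 1) (# 3) (# 7) (# 5)
cornerWord (outer B d) = dirCycle d (# 0) (# 4) (# 6) (# 2)
cornerWord (outer R d) = dirCycle d (# 4) (# 5) (# 7) (# 6)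
cornerWord (outer L d) = dirCycle d (# 0) (# 2) (# 3) (# 1)
cornerWord inner       = []

abstract
  -- A face turn is a 4-cycle, hence odd, on both kinds of cubies; for `inner` both words are empty.
  edge-corner-parity : ∀ g → odd (length (edgeWord g)) ≡ odd (length (cornerWord g))
  edge-corner-parity = decide (∀ᵍ? λ g → _ ≟ᵇ _)

-- Read off from facelet `false`; by `step-sticker` the other facelet of the edge is relabelled in
-- the same way.
flip : Gen → Fin 12 → Bool
flip g i = secondˢ (step g (sticker i false))

abstract
  step-sticker : ∀ g i s → step g (sticker i s) ≡ sticker (adjs (edgeWord g) ⟨$⟩ʳ i) (s xor flip g i)
  step-sticker = decide (∀ᵍ? λ g → all? λ i → ∀ᵇ? λ s → _ ≟ˢ _)

cornerIdx : Bool → Bool → Bool → Fin 8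
cornerIdx false false false = # 0
cornerIdx false false true  = # 1
cornerIdx false true  false = # 2
cornerIdx false true  true  = # 3
cornerIdx true  false false = # 4
cornerIdx true  false true  = # 5
cornerIdx true  true  false = # 6
cornerIdx true  true  true  = # 7

-- The binary digits of `i` are the sides of the corner along the three axes, and `r` is the axis
-- that the sticker faces.
cornerSticker : Fin 8 → Fin 3 → SPt
cornerSticker i r = spt (at 0F (hi₁ i)) (at 1F (hi₂ i)) (at 2F (hi₃ i))
  where
  at : Fin 3 → Bool → Coord
  at axis h = side h (does (axis ≟ r))
  hi₁ hi₂ hi₃ : Fin 8 → Bool
  hi₁ i = 3 <ᵇ toℕ i
  hi₂ i = 1 <ᵇ toℕ i % 4
  hi₃ i = 0 <ᵇ toℕ i % 2

facing : SPt → Fin 3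
facing (spt a b c) = if isBdˢ a then 0F else if isBdˢ b then 1F else 2F

abstract
  -- The parity argument follows corner positions, so the axis that the sticker faces afterwards is
  -- simply read off from its image.
  step-corner : ∀ g i r → step g (cornerSticker i r) ≡
    cornerSticker (adjs (cornerWord g) ⟨$⟩ʳ i) (facing (step g (cornerSticker i r)))
  step-corner = decide (∀ᵍ? λ g → all? λ i → all? λ r → _ ≟ˢ _)

cornerIdxˢ : SPt → Fin 8
cornerIdxˢ (spt a b c) = cornerIdx (hiˢ a) (hiˢ b) (hiˢ c)

abstract
  cornerIdx-sticker : ∀ i r → cornerIdxˢ (cornerSticker i r) ≡ i
  cornerIdx-sticker = decide (all? λ i → all? λ r → _ ≟ _)

  corner-facelet : ∀ i r → T (faceletˢ (cornerSticker i r)) × ¬ T (edgeˢ (cornerSticker i r))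
  corner-facelet = decide (all? λ i → all? λ r →
    T? (faceletˢ (cornerSticker i r)) ×-dec ¬? (T? (edgeˢ (cornerSticker i r))))

  edge-point : ∀ i j k → T (edgeˢ (point i j k)) →
    point i j k ≡ sticker (edgeIdxˢ (point i j k)) (secondˢ (point i j k))
  edge-point = decide (all? λ i → all? λ j → all? λ k → T? (edgeˢ (point i j k)) →-dec (_ ≟ˢ _))

  sticker-idx : ∀ i s → edgeIdxˢ (sticker i s) ≡ i × secondˢ (sticker i s) ≡ s
  sticker-idx = decide (all? λ i → ∀ᵇ? λ s → (_ ≟ _) ×-dec (_ ≟ᵇ _))

  sticker-edge : ∀ i s → T (edgeˢ (sticker i s))
  sticker-edge = decide (all? λ i → ∀ᵇ? λ s → T? (edgeˢ (sticker i s)))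

  turn-sticker-edge : ∀ f i s → T (edgeˢ (turnˢ f (sticker i s)))
  turn-sticker-edge = decide (∀ᶠ? λ f → all? λ i → ∀ᵇ? λ s → T? (edgeˢ (turnˢ f (sticker i s))))

-- Words of generators acting on single edges and corners

edgeWords : List Gen → List (Fin 11)
edgeWords = concatMap edgeWord

cornerWords : List Gen → List (Fin 7)
cornerWords = concatMap cornerWord

edgeWords-cornerWords : ∀ w → odd (length (edgeWords w)) ≡ odd (length (cornerWords w))
edgeWords-cornerWords []      = refl
edgeWords-cornerWords (g ∷ w)
  rewrite length-++ (edgeWord g) {edgeWords w} | length-++ (cornerWord g) {cornerWords w}
        | odd-+ (length (edgeWord g)) (length (edgeWords w))
        | odd-+ (length (cornerWord g)) (length (cornerWords w)) =
  cong₂ _xor_ (edge-corner-parity g) (edgeWords-cornerWords w)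

flips : List Gen → Fin 12 → Bool
flips []      i = false
flips (g ∷ w) i = flips w i xor flip g (adjs (edgeWords w) ⟨$⟩ʳ i)

run-sticker : ∀ w i s → run w (sticker i s) ≡ sticker (adjs (edgeWords w) ⟨$⟩ʳ i) (s xor flips w i)
run-sticker []      i s = cong (sticker i) (sym (xor-identityʳ s))
run-sticker (g ∷ w) i s = begin
  step g (run w (sticker i s))
    ≡⟨ cong (step g) (run-sticker w i s) ⟩
  step g (sticker i′ (s xor flips w i))
    ≡⟨ step-sticker g i′ _ ⟩
  sticker (adjs (edgeWord g) ⟨$⟩ʳ i′) ((s xor flips w i) xor flip g i′)
    ≡⟨ cong₂ sticker (sym (adjs-++ (edgeWord g) (edgeWords w) i)) (xor-assoc s (flips w i) (flip g i′)) ⟩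
  sticker (adjs (edgeWords (g ∷ w)) ⟨$⟩ʳ i) (s xor flips (g ∷ w) i) ∎
  where
  open ≡-Reasoning
  i′ : Fin 12
  i′ = adjs (edgeWords w) ⟨$⟩ʳ i

run-corner : ∀ w i r → ∃ λ r′ → run w (cornerSticker i r) ≡ cornerSticker (adjs (cornerWords w) ⟨$⟩ʳ i) r′
run-corner []      i r = r , refl
run-corner (g ∷ w) i r with run-corner w i r
... | r′ , eq = r″ , trans (cong (step g) eq) (trans (step-corner g i′ r′)
  (cong (λ k → cornerSticker k r″) (sym (adjs-++ (cornerWord g) (cornerWords w) i))))
  where
  i′ : Fin 8
  i′ = adjs (cornerWords w) ⟨$⟩ʳ i
  r″ : Fin 3
  r″ = facing (step g (cornerSticker i′ r′))

-- Interpretation in the n×n×n cube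

≡ᵇ-true : ∀ {a b} → a ≡ b → (a ≡ᵇ b) ≡ true
≡ᵇ-true {a} {b} eq = Equivalence.to T-≡ (≡⇒≡ᵇ a b eq)

≡ᵇ-false : ∀ {a b} → a ≢ b → (a ≡ᵇ b) ≡ false
≡ᵇ-false {a} {b} a≢b with a ≡ᵇ b in eq
... | false = refl
... | true  = contradiction (≡ᵇ⇒≡ a b (subst T (sym eq) tt)) a≢b

eval-++ : ∀ n (w w′ : List Move) p → eval n (w ++ w′) p ≡ eval n w (eval n w′ p)
eval-++ n []      w′ p = refl
eval-++ n (m ∷ w) w′ p = cong (applyMove n m) (eval-++ n w w′ p)

module Cube (n : ℕ) (3≤n : 3 ≤ n) (n-odd : n ≡ suc (n / 2 * 2)) where

  q : ℕ
  q = n / 2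

  1≤q : 1 ≤ q
  1≤q = go q (subst (3 ≤_) n-odd 3≤n)
    where
    go : ∀ r → 3 ≤ suc (r * 2) → 1 ≤ r
    go zero    (s≤s ())
    go (suc r) _ = s≤s z≤n

  1+n≡2+2q : suc n ≡ suc q + suc q
  1+n≡2+2q = cong suc (begin
    n                 ≡⟨ n-odd ⟩
    suc (q * 2)       ≡⟨ cong suc (*-comm q 2) ⟩
    suc (q + (q + 0)) ≡⟨ cong (λ r → suc (q + r)) (+-identityʳ q) ⟩
    suc (q + q)       ≡⟨ +-suc q q ⟨
    q + suc q         ∎)
    where open ≡-Reasoning

  1+q<n : suc q < n
  1+q<n = s≤s⁻¹ (begin
    2 + suc q     ≡⟨ +-comm 2 (suc q) ⟩
    suc q + 2     ≤⟨ +-monoʳ-≤ (suc q) (s≤s 1≤q) ⟩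
    suc q + suc q ≡⟨ 1+n≡2+2q ⟨
    suc n         ∎)
    where open ≤-Reasoning

  -- Grid coordinates and their reflection

  Grid : Set
  Grid = Fin (suc (suc n))

  Inner : ℕ → Set
  Inner v = 1 < v × v < n × v ≢ suc q

  toℕ+opposite : ∀ (i : Grid) → toℕ i + toℕ (opposite i) ≡ suc n
  toℕ+opposite i = trans (cong (toℕ i +_) (opposite-prop i)) (m+[n∸m]≡n (toℕ≤pred[n] i))

  -- Phrased through the sum `v + v′`, so that it serves both for `opposite` and for passing between
  -- the slice numbers `k` and `suc n ∸ k`.
  Inner-reflect : ∀ {v v′} → v + v′ ≡ suc n → Inner v → Inner v′
  Inner-reflect {v} {v′} sum (1<v , v<n , v≢) =
    +-cancelˡ-≤ v 2 v′ (begin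
      v + 2       ≡⟨ +-comm v 2 ⟩
      2 + v       ≤⟨ s≤s v<n ⟩
      suc n       ≡⟨ sum ⟨
      v + v′      ∎) ,
    s≤s⁻¹ (begin
      2 + v′      ≤⟨ +-monoˡ-≤ v′ 1<v ⟩
      v + v′      ≡⟨ sum ⟩
      suc n       ∎) ,
    λ { refl → v≢ (+-cancelʳ-≡ (suc q) v (suc q) (trans sum 1+n≡2+2q)) }
    where open ≤-Reasoning

  1+q<2+n : suc q < suc (suc n)
  1+q<2+n = m≤n⇒m≤1+n (m≤n⇒m≤1+n 1+q<n)

  midpoint : Grid
  midpoint = fromℕ< 1+q<2+n

  toℕ-midpoint : toℕ midpoint ≡ suc q
  toℕ-midpoint = toℕ-fromℕ< 1+q<2+n

  opposite-midpoint : opposite midpoint ≡ midpoint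
  opposite-midpoint = toℕ-injective (trans
    (+-cancelˡ-≡ (suc q) _ _ (trans (cong (_+ toℕ (opposite midpoint)) (sym toℕ-midpoint))
      (trans (toℕ+opposite midpoint) 1+n≡2+2q)))
    (sym toℕ-midpoint))

  -- Values of symbolic facelets

  axis : Pt n → Fin 3 → Grid
  axis p 0F = x p
  axis p 1F = y p
  axis p 2F = z p

  val : Pt n → Coord → Grid
  val ρ out₋         = zero
  val ρ ext₋         = suc zero
  val ρ mid          = midpoint
  val ρ ext₊         = opposite (suc zero)
  val ρ out₊         = opposite zero
  val ρ (vr i false) = axis ρ i
  val ρ (vr i true)  = opposite (axis ρ i)

  ⟦_⟧_ : SPt → Pt n → Pt n
  ⟦ spt a b c ⟧ ρ = pt (val ρ a) (val ρ b) (val ρ c)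

  -- A variable may stand only for a coordinate that is none of the five special ones; otherwise the
  -- tests on symbols, which treat it as ordinary, could give wrong answers.
  Ok : Pt n → Coord → Set
  Ok ρ (sp _)   = ⊤
  Ok ρ (vr i _) = Inner (toℕ (axis ρ i))

  val-mirror : ∀ ρ c → opposite (val ρ c) ≡ val ρ (mirror c)
  val-mirror ρ out₋         = refl
  val-mirror ρ ext₋         = refl
  val-mirror ρ mid          = opposite-midpoint
  val-mirror ρ ext₊         = opposite-involutive _
  val-mirror ρ out₊         = opposite-involutive _
  val-mirror ρ (vr i false) = refl
  val-mirror ρ (vr i true)  = opposite-involutive _

  Inner-vr : ∀ ρ i b → Ok ρ (vr i b) → Inner (toℕ (val ρ (vr i b)))
  Inner-vr ρ i false ok = ok
  Inner-vr ρ i true  ok = Inner-reflect (toℕ+opposite (axis ρ i)) ok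

  toℕ-ext₊ : ∀ ρ → toℕ (val ρ ext₊) ≡ n
  toℕ-ext₊ ρ = suc-injective (toℕ+opposite (suc zero))

  toℕ-out₊ : ∀ ρ → toℕ (val ρ out₊) ≡ suc n
  toℕ-out₊ ρ = toℕ+opposite zero

  1≢n : 1 ≢ n
  1≢n = <⇒≢ (≤-trans (s≤s (s≤s z≤n)) 3≤n)

  1≢1+q : 1 ≢ suc q
  1≢1+q = <⇒≢ (s≤s 1≤q)

  -- These are the tests through which outer slices, facelets and single edges look at a coordinate.
  -- The soundness lemmas follow from the fields.
  record Agrees (i : Grid) (c : Coord) : Set where
    field
      bd    : isBd n i ≡ isBdˢ c
      md    : isMid n i ≡ isMidˢ c
      ext   : isExt n i ≡ isExtˢ c
      high  : hi n i ≡ hiˢ c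
      plus  : plusLayer n 1 i ≡ top c
      minus : minusLayer n 1 i ≡ bottom c
  open Agrees

  -- u is the value of clamp n i.
  agrees-at : ∀ {i} c v → toℕ i ≡ v →
    (v ≡ᵇ 0) ∨ (v ≡ᵇ suc n) ≡ isBdˢ c →
    ∀ {u} → (if v ≡ᵇ 0 then 1 else (if v ≡ᵇ suc n then n else v)) ≡ u →
    (u ≡ᵇ suc q) ≡ isMidˢ c →
    (u ≡ᵇ 1) ≡ bottom c → (u ≡ᵇ n) ≡ top c →
    (v ≡ᵇ n) ∨ (v ≡ᵇ suc n) ≡ top c →
    (v ≡ᵇ 1) ∨ (v ≡ᵇ 0) ≡ bottom c →
    Agrees i c
  agrees-at c v refl b refl m e₁ e₂ p₊ p₋ = record
    { bd = b ; md = m ; ext = cong₂ _∨_ e₁ e₂ ; high = e₂ ; plus = p₊ ; minus = p₋ }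

  agrees : ∀ ρ c → Ok ρ c → Agrees (val ρ c) c
  agrees ρ out₋ _ = agrees-at out₋ 0 refl refl refl (≡ᵇ-false 1≢1+q) refl (≡ᵇ-false 1≢n)
    (cong (_∨ false) (≡ᵇ-false {0} {n} (<⇒≢ (≤-trans (s≤s z≤n) 3≤n)))) refl
  agrees ρ ext₋ _ = agrees-at ext₋ 1 refl 1≢ᵇ1+n (cong (λ b → if b then n else 1) 1≢ᵇ1+n)
    (≡ᵇ-false 1≢1+q) refl (≡ᵇ-false 1≢n) (cong₂ _∨_ (≡ᵇ-false 1≢n) 1≢ᵇ1+n) refl
    where
    1≢ᵇ1+n : (1 ≡ᵇ suc n) ≡ false
    1≢ᵇ1+n = ≡ᵇ-false (<⇒≢ (s≤s (≤-trans (s≤s z≤n) 3≤n)))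
  agrees ρ mid _ = agrees-at mid (suc q) toℕ-midpoint
    out (cong (λ b → if b then n else suc q) out)
    (≡ᵇ-true {suc q} refl) (≡ᵇ-false (1≢1+q ∘ sym)) (≡ᵇ-false (<⇒≢ 1+q<n))
    (cong₂ _∨_ (≡ᵇ-false (<⇒≢ 1+q<n)) out) (cong (_∨ false) (≡ᵇ-false (1≢1+q ∘ sym)))
    where
    out : (suc q ≡ᵇ suc n) ≡ false
    out = ≡ᵇ-false (<⇒≢ (m≤n⇒m≤1+n 1+q<n))
  agrees ρ ext₊ _ = agrees-at ext₊ n (toℕ-ext₊ ρ)
    (cong₂ _∨_ n≢ᵇ0 n≢ᵇ1+n) (cong₂ (λ b c → if b then 1 else (if c then n else n)) n≢ᵇ0 n≢ᵇ1+n)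
    (≡ᵇ-false (<⇒≢ 1+q<n ∘ sym)) (≡ᵇ-false (1≢n ∘ sym)) (≡ᵇ-true {n} refl)
    (cong₂ _∨_ (≡ᵇ-true {n} refl) n≢ᵇ1+n) (cong₂ _∨_ (≡ᵇ-false (1≢n ∘ sym)) n≢ᵇ0)
    where
    n≢ᵇ0 : (n ≡ᵇ 0) ≡ false
    n≢ᵇ0 = ≡ᵇ-false (<⇒≢ (≤-trans (s≤s z≤n) 3≤n) ∘ sym)
    n≢ᵇ1+n : (n ≡ᵇ suc n) ≡ false
    n≢ᵇ1+n = ≡ᵇ-false (<⇒≢ (n<1+n n))
  agrees ρ out₊ _ = agrees-at out₊ (suc n) (toℕ-out₊ ρ)
    (≡ᵇ-true {suc n} refl) (cong (λ b → if b then n else suc n) (≡ᵇ-true {suc n} refl))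
    (≡ᵇ-false (<⇒≢ 1+q<n ∘ sym)) (≡ᵇ-false (1≢n ∘ sym)) (≡ᵇ-true {n} refl)
    (cong₂ _∨_ (≡ᵇ-false {suc n} (<⇒≢ (n<1+n n) ∘ sym)) (≡ᵇ-true {suc n} refl))
    (cong (_∨ false) (≡ᵇ-false {suc n} (<⇒≢ (s≤s (≤-trans (s≤s z≤n) 3≤n)) ∘ sym)))
  agrees ρ c@(vr i b) ok = agrees-at c v refl
    (cong₂ _∨_ v≢ᵇ0 v≢ᵇ1+n) (cong₂ (λ b c → if b then 1 else (if c then n else v)) v≢ᵇ0 v≢ᵇ1+n)
    (≡ᵇ-false (proj₂ (proj₂ inn))) (≡ᵇ-false (<⇒≢ (proj₁ inn) ∘ sym)) v≢ᵇn
    (cong₂ _∨_ v≢ᵇn v≢ᵇ1+n) (cong₂ _∨_ (≡ᵇ-false (<⇒≢ (proj₁ inn) ∘ sym)) v≢ᵇ0)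
    where
    v : ℕ
    v = toℕ (val ρ (vr i b))
    inn : Inner v
    inn = Inner-vr ρ i b ok
    v≢ᵇ0 : (v ≡ᵇ 0) ≡ false
    v≢ᵇ0 = ≡ᵇ-false (<⇒≢ (≤-trans (s≤s z≤n) (proj₁ inn)) ∘ sym)
    v≢ᵇn : (v ≡ᵇ n) ≡ false
    v≢ᵇn = ≡ᵇ-false (<⇒≢ (proj₁ (proj₂ inn)))
    v≢ᵇ1+n : (v ≡ᵇ suc n) ≡ false
    v≢ᵇ1+n = ≡ᵇ-false (<⇒≢ (m≤n⇒m≤1+n (proj₁ (proj₂ inn))))

  -- Soundness of the symbolic moves

  AllC : (Coord → Set) → SPt → Set
  AllC P (spt a b c) = P a × P b × P c

  -- Moves only permute and mirror coordinates, so any property preserved by `mirror` persists. The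
  -- instances are `Ok` and `Special`.
  module _ {P : Coord → Set} (P-mirror : ∀ c → P c → P (mirror c)) where

    AllC-turn : ∀ f s → AllC P s → AllC P (turnˢ f s)
    AllC-turn R s (a , b , c) = a , c , P-mirror _ b
    AllC-turn L s = AllC-turn R (rXˢ (rXˢ s)) ∘ AllC-turn R (rXˢ s) ∘ AllC-turn R s
    AllC-turn U s (a , b , c) = P-mirror _ c , b , a
    AllC-turn D s = AllC-turn U (rYˢ (rYˢ s)) ∘ AllC-turn U (rYˢ s) ∘ AllC-turn U s
    AllC-turn F s (a , b , c) = b , P-mirror _ a , c
    AllC-turn B s = AllC-turn F (rZˢ (rZˢ s)) ∘ AllC-turn F (rZˢ s) ∘ AllC-turn F s

    AllC-step : ∀ g s → AllC P s → AllC P (step g s)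
    AllC-step (outer f cw) s ps with onFace f s
    ... | true  = AllC-turn f s ps
    ... | false = ps
    AllC-step (outer f ccw) s ps with onFace f s
    ... | true  = AllC-turn f _ (AllC-turn f _ (AllC-turn f s ps))
    ... | false = ps
    AllC-step inner s ps with isVar (sx s)
    ... | true  = AllC-turn R s ps
    ... | false = ps

  Ok-mirror : ∀ ρ c → Ok ρ c → Ok ρ (mirror c)
  Ok-mirror ρ out₋     _  = tt
  Ok-mirror ρ ext₋     _  = tt
  Ok-mirror ρ mid      _  = tt
  Ok-mirror ρ ext₊     _  = tt
  Ok-mirror ρ out₊     _  = tt
  Ok-mirror ρ (vr i b) ok = ok

  Special : Coord → Set
  Special c = isVar c ≡ false

  Special-mirror : ∀ c → Special c → Special (mirror c)
  Special-mirror out₋ _ = refl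
  Special-mirror ext₋ _ = refl
  Special-mirror mid  _ = refl
  Special-mirror ext₊ _ = refl
  Special-mirror out₊ _ = refl

  special⇒ok : ∀ ρ s → AllC Special s → AllC (Ok ρ) s
  special⇒ok ρ (spt (sp _) (sp _) (sp _)) _ = tt , tt , tt

  turn-sound : ∀ ρ f s → turn f (⟦ s ⟧ ρ) ≡ ⟦ turnˢ f s ⟧ ρ
  turn-sound ρ R (spt a b c) = cong (pt (val ρ a) (val ρ c)) (val-mirror ρ b)
  turn-sound ρ L s = trans (cong (rX ∘ rX) (turn-sound ρ R s))
    (trans (cong rX (turn-sound ρ R (rXˢ s))) (turn-sound ρ R (rXˢ (rXˢ s))))
  turn-sound ρ U (spt a b c) = cong (λ i → pt i (val ρ b) (val ρ a)) (val-mirror ρ c)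
  turn-sound ρ D s = trans (cong (rY ∘ rY) (turn-sound ρ U s))
    (trans (cong rY (turn-sound ρ U (rYˢ s))) (turn-sound ρ U (rYˢ (rYˢ s))))
  turn-sound ρ F (spt a b c) = cong (λ i → pt (val ρ b) i (val ρ c)) (val-mirror ρ a)
  turn-sound ρ B s = trans (cong (rZ ∘ rZ) (turn-sound ρ F s))
    (trans (cong rZ (turn-sound ρ F (rZˢ s))) (turn-sound ρ F (rZˢ (rZˢ s))))

  onFace-sound : ∀ ρ f s → AllC (Ok ρ) s → inSlice n f 1 (⟦ s ⟧ ρ) ≡ onFace f s
  onFace-sound ρ R s (a , b , c) = plus  (agrees ρ _ a)
  onFace-sound ρ L s (a , b , c) = minus (agrees ρ _ a)
  onFace-sound ρ U s (a , b , c) = plus  (agrees ρ _ b)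
  onFace-sound ρ D s (a , b , c) = minus (agrees ρ _ b)
  onFace-sound ρ F s (a , b , c) = plus  (agrees ρ _ c)
  onFace-sound ρ B s (a , b , c) = minus (agrees ρ _ c)

  outer-sound : ∀ ρ f d s → AllC (Ok ρ) s → applyMove n (mv f 1 d) (⟦ s ⟧ ρ) ≡ ⟦ step (outer f d) s ⟧ ρ
  outer-sound ρ f cw s ok rewrite onFace-sound ρ f s ok with onFace f s
  ... | true  = turn-sound ρ f s
  ... | false = refl
  outer-sound ρ f ccw s ok rewrite onFace-sound ρ f s ok with onFace f s
  ... | true  = trans (cong (turn f ∘ turn f) (turn-sound ρ f s))
    (trans (cong (turn f) (turn-sound ρ f (turnˢ f s))) (turn-sound ρ f (turnˢ f (turnˢ f s))))
  ... | false = refl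

  -- v is the x-coordinate of the k-th slice from R or from L.
  At : ℕ → ℕ → Set
  At k v = v ≡ suc n ∸ k ⊎ v ≡ k

  k≤1+n : ∀ {k} → k ≤ q → k ≤ suc n
  k≤1+n k≤q = ≤-trans k≤q (≤-trans (n≤1+n q) (≤-trans (<⇒≤ 1+q<n) (n≤1+n n)))

  Inner-low : ∀ {k} → 2 ≤ k → k ≤ q → Inner k
  Inner-low 2≤k k≤q = 2≤k , ≤-trans (s≤s k≤q) (<⇒≤ 1+q<n) , <⇒≢ (s≤s k≤q)

  At⇒Inner : ∀ {k v} → 2 ≤ k → k ≤ q → At k v → Inner v
  At⇒Inner {k} 2≤k k≤q (inj₁ refl) = Inner-reflect (m+[n∸m]≡n (k≤1+n k≤q)) (Inner-low 2≤k k≤q)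
  At⇒Inner     2≤k k≤q (inj₂ refl) = Inner-low 2≤k k≤q

  -- The slices counted from the two sides are disjoint because `k + l` is at most 2q, which is less
  -- than n + 1.
  low≢high : ∀ {k l} → k ≤ q → l ≤ q → k ≢ suc n ∸ l
  low≢high {k} {l} k≤q l≤q eq = <-irrefl refl (begin-strict
    suc n         ≡⟨ m∸n+n≡m (k≤1+n l≤q) ⟨
    suc n ∸ l + l ≡⟨ cong (_+ l) eq ⟨
    k + l         ≤⟨ +-mono-≤ k≤q l≤q ⟩
    q + q         <⟨ +-mono-< (n<1+n q) (n<1+n q) ⟩
    suc q + suc q ≡⟨ 1+n≡2+2q ⟨
    suc n         ∎)
    where open ≤-Reasoning

  At-unique : ∀ {k l v} → k ≤ q → l ≤ q → At k v → At l v → k ≡ l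
  At-unique k≤q l≤q (inj₁ refl) (inj₁ eq) = ∸-cancelˡ-≡ (k≤1+n k≤q) (k≤1+n l≤q) eq
  At-unique k≤q l≤q (inj₁ refl) (inj₂ eq) = contradiction (sym eq) (low≢high l≤q k≤q)
  At-unique k≤q l≤q (inj₂ refl) (inj₁ eq) = contradiction eq (low≢high k≤q l≤q)
  At-unique k≤q l≤q (inj₂ refl) (inj₂ eq) = eq

  Inner⇒At : ∀ {v} → Inner v → ∃ λ k → 2 ≤ k × k ≤ q × At k v
  Inner⇒At {v} inn@(1<v , v<n , v≢) with v ≤? q
  ... | yes v≤q = v , 1<v , v≤q , inj₂ refl
  ... | no  v≰q = suc n ∸ v , proj₁ (Inner-reflect v+w inn) , w≤q , inj₁ (sym (m∸[m∸n]≡n v≤1+n))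
    where
    v≤1+n : v ≤ suc n
    v≤1+n = ≤-trans (<⇒≤ v<n) (n≤1+n n)
    v+w : v + (suc n ∸ v) ≡ suc n
    v+w = m+[n∸m]≡n v≤1+n
    w≤q : suc n ∸ v ≤ q
    -- From `q < v` and `v ≢ suc q` follows q + 2 ≤ v, and n + 1 = 2q + 2 leaves at most q.
    w≤q = ≤-trans (∸-monoʳ-≤ (suc n) (≤∧≢⇒< (≰⇒> v≰q) (v≢ ∘ sym)))
      (≤-reflexive (trans (cong (_∸ suc (suc q)) (trans 1+n≡2+2q (+-suc (suc q) q))) (m+n∸m≡n (suc (suc q)) q)))

  plusLayer-deep : ∀ {k} → 2 ≤ k → ∀ i → plusLayer n k i ≡ (toℕ i ≡ᵇ suc n ∸ k)
  -- Matching on `2 ≤ k` exposes two successors in `k`, so that `k ≡ᵇ 1` computes to `false`.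
  plusLayer-deep (s≤s (s≤s _)) i = ∨-identityʳ _

  minusLayer-deep : ∀ {k} → 2 ≤ k → ∀ i → minusLayer n k i ≡ (toℕ i ≡ᵇ k)
  minusLayer-deep (s≤s (s≤s _)) i = ∨-identityʳ _

  rX⁴ : ∀ (p : Pt n) → rX (rX (rX (rX p))) ≡ p
  rX⁴ (pt a b c) = cong₂ (pt a) (opposite-involutive b) (opposite-involutive c)

  -- Nine applications of `rX` reduce to one by `rX⁴`: counterclockwise for `L` is the same sense of
  -- rotation as clockwise for `R`.
  turn-L³ : ∀ (p : Pt n) → turn L (turn L (turn L p)) ≡ rX p
  turn-L³ p = cong rX (trans (rX⁴ _) (rX⁴ p))

  R-hit : ∀ {k} → 2 ≤ k → ∀ p → toℕ (x p) ≡ suc n ∸ k → applyMove n (mv R k cw) p ≡ rX p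
  R-hit 2≤k p eq = cong (λ b → if b then rX p else p) (trans (plusLayer-deep 2≤k (x p)) (≡ᵇ-true eq))

  R-miss : ∀ {k} → 2 ≤ k → ∀ p → toℕ (x p) ≢ suc n ∸ k → applyMove n (mv R k cw) p ≡ p
  R-miss 2≤k p neq = cong (λ b → if b then rX p else p) (trans (plusLayer-deep 2≤k (x p)) (≡ᵇ-false neq))

  L-hit : ∀ {k} → 2 ≤ k → ∀ p → toℕ (x p) ≡ k → applyMove n (mv L k ccw) p ≡ rX p
  L-hit 2≤k p eq = trans
    (cong (λ b → if b then turn L (turn L (turn L p)) else p) (trans (minusLayer-deep 2≤k (x p)) (≡ᵇ-true eq)))
    (turn-L³ p)

  L-miss : ∀ {k} → 2 ≤ k → ∀ p → toℕ (x p) ≢ k → applyMove n (mv L k ccw) p ≡ p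
  L-miss 2≤k p neq =
    cong (λ b → if b then turn L (turn L (turn L p)) else p) (trans (minusLayer-deep 2≤k (x p)) (≡ᵇ-false neq))

  -- Both mirror-image slices turn in the same sense about the x-axis, so the effect on a variable
  -- coordinate does not depend on its side of the middle.
  pair : ℕ → List Move
  pair k = mv R k cw ∷ mv L k ccw ∷ []

  pair-hit : ∀ {k} → 2 ≤ k → k ≤ q → ∀ p → At k (toℕ (x p)) → eval n (pair k) p ≡ rX p
  pair-hit {k} 2≤k k≤q p (inj₁ eq) = trans
    (cong (applyMove n (mv R k cw)) (L-miss 2≤k p λ eq′ → low≢high k≤q k≤q (trans (sym eq′) eq)))
    (R-hit 2≤k p eq)
  pair-hit {k} 2≤k k≤q p (inj₂ eq) = trans
    (cong (applyMove n (mv R k cw)) (L-hit 2≤k p eq))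
    -- `rX` preserves the x-coordinate, so `eq` still speaks of the turned point.
    (R-miss 2≤k (rX p) λ eq′ → low≢high k≤q k≤q (trans (sym eq) eq′))

  pair-miss : ∀ {k} → 2 ≤ k → ∀ p → ¬ At k (toℕ (x p)) → eval n (pair k) p ≡ p
  pair-miss {k} 2≤k p ¬at = trans
    (cong (applyMove n (mv R k cw)) (L-miss 2≤k p (¬at ∘ inj₂)))
    (R-miss 2≤k p (¬at ∘ inj₁))

  -- The layers 2, …, j+1 on both sides.
  slices : ℕ → List Move
  slices zero    = []
  slices (suc j) = pair (2 + j) ++ slices j

  slices-miss : ∀ j p → (∀ {k} → 2 ≤ k → k ≤ suc j → ¬ At k (toℕ (x p))) → eval n (slices j) p ≡ p
  slices-miss zero    p ¬at = refl
  slices-miss (suc j) p ¬at = trans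
    (cong (eval n (pair (2 + j))) (slices-miss j p (λ 2≤k k≤ → ¬at 2≤k (m≤n⇒m≤1+n k≤))))
    (pair-miss (s≤s (s≤s z≤n)) p (¬at (s≤s (s≤s z≤n)) ≤-refl))

  -- By `At-unique` exactly one pair moves `p`, and since the turn keeps the x-coordinate, the pairs
  -- before and after it do nothing.
  slices-hit : ∀ j p {k} → suc j ≤ q → 2 ≤ k → k ≤ suc j → At k (toℕ (x p)) → eval n (slices j) p ≡ rX p
  slices-hit zero    p j<q (s≤s (s≤s _)) (s≤s ()) at
  slices-hit (suc j) p {k} j<q 2≤k k≤ at with k ≟ⁿ 2 + j
  ... | yes refl = trans
    (cong (eval n (pair (2 + j))) (slices-miss j p λ {l} 2≤l l≤ at′ →
      <-irrefl (At-unique (≤-trans (m≤n⇒m≤1+n l≤) j<q) j<q at′ at) (s≤s l≤)))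
    (pair-hit 2≤k j<q p at)
  ... | no k≢ = trans
    (cong (eval n (pair (2 + j))) (slices-hit j p (<⇒≤ j<q) 2≤k (s≤s⁻¹ (≤∧≢⇒< k≤ k≢)) at))
    (pair-miss (s≤s (s≤s z≤n)) (rX p) λ at′ → k≢ (At-unique (≤-trans k≤ j<q) j<q at at′))

  -- `slices j` reaches layer j + 1, so `slices (q ∸ 1)` covers exactly the layers 2 to q and is
  -- empty when n = 3.
  1+[q∸1]≡q : suc (q ∸ 1) ≡ q
  1+[q∸1]≡q = m+[n∸m]≡n 1≤q

  ¬Inner-special : ∀ ρ c → Special c → ¬ Inner (toℕ (val ρ c))
  ¬Inner-special ρ out₋ _ (() , _)
  ¬Inner-special ρ ext₋ _ (s≤s () , _)
  ¬Inner-special ρ mid  _ (_ , _ , v≢) = v≢ toℕ-midpoint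
  ¬Inner-special ρ ext₊ _ (_ , v<n , _) = <-irrefl (toℕ-ext₊ ρ) v<n
  ¬Inner-special ρ out₊ _ (_ , v<n , _) = <-asym v<n (subst (n <_) (sym (toℕ-out₊ ρ)) (n<1+n n))

  inner-sound : ∀ ρ s → AllC (Ok ρ) s → eval n (slices (q ∸ 1)) (⟦ s ⟧ ρ) ≡ ⟦ step inner s ⟧ ρ
  inner-sound ρ s@(spt c@(sp _) _ _) _ = slices-miss (q ∸ 1) (⟦ s ⟧ ρ) λ {k} 2≤k k≤ at →
    ¬Inner-special ρ c refl (At⇒Inner 2≤k (subst (k ≤_) 1+[q∸1]≡q k≤) at)
  inner-sound ρ s@(spt (vr i b) _ _) (ok , _) with Inner⇒At (Inner-vr ρ i b ok)
  ... | k , 2≤k , k≤q , at = trans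
    (slices-hit (q ∸ 1) (⟦ s ⟧ ρ) (≤-reflexive 1+[q∸1]≡q) 2≤k (subst (k ≤_) (sym 1+[q∸1]≡q) k≤q) at)
    (turn-sound ρ R s)

  expand : Gen → List Move
  expand (outer f d) = mv f 1 d ∷ []
  expand inner       = slices (q ∸ 1)

  word : List Gen → List Move
  word = concatMap expand

  expand-sound : ∀ ρ g s → AllC (Ok ρ) s → eval n (expand g) (⟦ s ⟧ ρ) ≡ ⟦ step g s ⟧ ρ
  expand-sound ρ (outer f d) = outer-sound ρ f d
  expand-sound ρ inner       = inner-sound ρ

  AllC-run : ∀ {P} → (∀ c → P c → P (mirror c)) → ∀ w s → AllC P s → AllC P (run w s)
  AllC-run P-mirror []      s ps = ps
  AllC-run P-mirror (g ∷ w) s ps = AllC-step P-mirror g _ (AllC-run P-mirror w s ps)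

  word-sound : ∀ ρ w s → AllC (Ok ρ) s → eval n (word w) (⟦ s ⟧ ρ) ≡ ⟦ run w s ⟧ ρ
  word-sound ρ []      s ok = refl
  word-sound ρ (g ∷ w) s ok = trans (eval-++ n (expand g) (word w) _)
    (trans (cong (eval n (expand g)) (word-sound ρ w s ok))
      (expand-sound ρ g (run w s) (AllC-run (Ok-mirror ρ) w s ok)))

  valid-layer : ∀ {f k d} → 1 ≤ k → k ≤ q → ValidMove n (mv f k d)
  valid-layer 1≤k k≤q = Equivalence.from T-∧ (<⇒<ᵇ 1≤k , <⇒<ᵇ (s≤s k≤q))

  slices-valid : ∀ j → suc j ≤ q → All (ValidMove n) (slices j)
  slices-valid zero    _   = []
  slices-valid (suc j) j<q = valid-layer {R} {2 + j} {cw} (s≤s z≤n) j<q ∷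
    valid-layer {L} {2 + j} {ccw} (s≤s z≤n) j<q ∷ slices-valid j (<⇒≤ j<q)

  word-valid : ∀ w → All (ValidMove n) (word w)
  word-valid []              = []
  word-valid (outer f d ∷ w) = valid-layer {f} {1} {d} ≤-refl 1≤q ∷ word-valid w
  word-valid (inner ∷ w)     = ++⁺ (slices-valid (q ∸ 1) (≤-reflexive 1+[q∸1]≡q)) (word-valid w)

  -- Arbitrary words reduced to face turns on single edges and corners

  inSlice-deep : ∀ ρ f {k} s → AllC Special s → 2 ≤ k → k ≤ q → inSlice n f k (⟦ s ⟧ ρ) ≡ false
  inSlice-deep ρ f {k} s (a , b , c) 2≤k k≤q = go f
    where
    above : ∀ d → Special d → plusLayer n k (val ρ d) ≡ false
    above d sd = trans (plusLayer-deep 2≤k (val ρ d))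
      (≡ᵇ-false λ eq → ¬Inner-special ρ d sd (At⇒Inner 2≤k k≤q (inj₁ eq)))
    below : ∀ d → Special d → minusLayer n k (val ρ d) ≡ false
    below d sd = trans (minusLayer-deep 2≤k (val ρ d))
      (≡ᵇ-false λ eq → ¬Inner-special ρ d sd (At⇒Inner 2≤k k≤q (inj₂ eq)))
    go : ∀ f → inSlice n f k (⟦ s ⟧ ρ) ≡ false
    go R = above _ a
    go L = below _ a
    go U = above _ b
    go D = below _ b
    go F = above _ c
    go B = below _ c

  outerPart : List Move → List Gen
  outerPart []             = []
  outerPart (mv f k d ∷ w) = if k ≡ᵇ 1 then outer f d ∷ outerPart w else outerPart w

  outerPart-sound : ∀ ρ w s → All (ValidMove n) w → AllC Special s →
    eval n w (⟦ s ⟧ ρ) ≡ ⟦ run (outerPart w) s ⟧ ρ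
  outerPart-sound ρ []                   s []       sp-s = refl
  outerPart-sound ρ (mv f 0 d ∷ w)       s (() ∷ _) sp-s
  outerPart-sound ρ (mv f 1 d ∷ w)       s (_ ∷ vs) sp-s = trans
    (cong (applyMove n (mv f 1 d)) (outerPart-sound ρ w s vs sp-s))
    (outer-sound ρ f d _ (special⇒ok ρ _ (AllC-run Special-mirror (outerPart w) s sp-s)))
  outerPart-sound ρ (mv f k@(suc (suc _)) d ∷ w) s (v ∷ vs) sp-s = trans
    (cong (applyMove n (mv f k d)) (outerPart-sound ρ w s vs sp-s))
    (idle d (inSlice-deep ρ f _ (AllC-run Special-mirror (outerPart w) s sp-s) (s≤s (s≤s z≤n))
      (s≤s⁻¹ (<ᵇ⇒< k (suc q) (proj₂ (Equivalence.to T-∧ v))))))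
    where
    idle : ∀ d {p} → inSlice n f k p ≡ false → applyMove n (mv f k d) p ≡ p
    idle cw  eq = cong (λ b → if b then _ else _) eq
    idle ccw eq = cong (λ b → if b then _ else _) eq

  -- Facelets of the cube as symbolic facelets

  classify : ∀ (a : Grid) → (∃ λ c → ∀ ρ → a ≡ val ρ (sp c)) ⊎ Inner (toℕ a)
  classify a with toℕ a ≟ⁿ 0 | toℕ a ≟ⁿ 1 | toℕ a ≟ⁿ suc q | toℕ a ≟ⁿ n | toℕ a ≟ⁿ suc n
  ... | yes e | _ | _ | _ | _ = inj₁ (0F , λ _ → toℕ-injective e)
  ... | _ | yes e | _ | _ | _ = inj₁ (1F , λ _ → toℕ-injective e)
  ... | _ | _ | yes e | _ | _ = inj₁ (2F , λ _ → toℕ-injective (trans e (sym toℕ-midpoint)))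
  ... | _ | _ | _ | yes e | _ = inj₁ (3F , λ ρ → toℕ-injective (trans e (sym (toℕ-ext₊ ρ))))
  ... | _ | _ | _ | _ | yes e = inj₁ (4F , λ ρ → toℕ-injective (trans e (sym (toℕ-out₊ ρ))))
  ... | no ≢0 | no ≢1 | no ≢mid | no ≢n | no ≢1+n = inj₂
    ( ≤∧≢⇒< (n≢0⇒n>0 ≢0) (≢1 ∘ sym)
    , ≤∧≢⇒< (s≤s⁻¹ (≤∧≢⇒< (toℕ≤pred[n] a) ≢1+n)) ≢n
    , ≢mid )

  symbol : ∀ ρ i → ∃ λ k → axis ρ i ≡ val ρ (sym6 i k) × Ok ρ (sym6 i k)
  symbol ρ i with classify (axis ρ i)
  ... | inj₂ inn       = 5F , refl , inn
  ... | inj₁ (0F , eq) = 0F , eq ρ , tt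
  ... | inj₁ (1F , eq) = 1F , eq ρ , tt
  ... | inj₁ (2F , eq) = 2F , eq ρ , tt
  ... | inj₁ (3F , eq) = 3F , eq ρ , tt
  ... | inj₁ (4F , eq) = 4F , eq ρ , tt

  pointOf : ∀ p → ∃ λ ((i , j , k) : Fin 6 × Fin 6 × Fin 6) →
    p ≡ ⟦ point i j k ⟧ p × AllC (Ok p) (point i j k)
  pointOf p with symbol p 0F | symbol p 1F | symbol p 2F
  ... | i , ex , okx | j , ey , oky | k , ez , okz =
    (i , j , k) , trans (cong₂ (λ a b → pt a b (z p)) ex ey) (cong (pt _ _) ez) , okx , oky , okz

  facelet-sound : ∀ ρ s → AllC (Ok ρ) s → Facelet n (⟦ s ⟧ ρ) ≡ T (faceletˢ s)
  facelet-sound ρ s (a , b , c)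
    rewrite bd (agrees ρ _ a) | bd (agrees ρ _ b) | bd (agrees ρ _ c) = refl

  edge-sound : ∀ ρ s → AllC (Ok ρ) s → SingleEdge n (⟦ s ⟧ ρ) ≡ (T (faceletˢ s) × T (edgeShape s))
  edge-sound ρ s ok@(a , b , c)
    rewrite facelet-sound ρ s ok
          | md (agrees ρ _ a) | md (agrees ρ _ b) | md (agrees ρ _ c)
          | ext (agrees ρ _ a) | ext (agrees ρ _ b) | ext (agrees ρ _ c) = refl

  edge⇒ : ∀ ρ s → AllC (Ok ρ) s → SingleEdge n (⟦ s ⟧ ρ) → T (edgeˢ s)
  edge⇒ ρ s ok se = Equivalence.from T-∧ (subst id (edge-sound ρ s ok) se)

  edge⇐ : ∀ ρ s → AllC (Ok ρ) s → T (edgeˢ s) → SingleEdge n (⟦ s ⟧ ρ)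
  edge⇐ ρ s ok t = subst id (sym (edge-sound ρ s ok)) (Equivalence.to T-∧ t)

  edgeIdx-sound : ∀ ρ s → AllC (Ok ρ) s → edgeIdx n (⟦ s ⟧ ρ) ≡ edgeIdxˢ s
  edgeIdx-sound ρ s (a , b , c)
    rewrite md (agrees ρ _ a) | md (agrees ρ _ b)
          | high (agrees ρ _ a) | high (agrees ρ _ b) | high (agrees ρ _ c) = refl

  second-sound : ∀ ρ s → AllC (Ok ρ) s → second n (⟦ s ⟧ ρ) ≡ secondˢ s
  second-sound ρ s (a , b , c)
    rewrite md (agrees ρ _ a) | md (agrees ρ _ b) | bd (agrees ρ _ b) | bd (agrees ρ _ c) = refl

  abstract
    special-sticker : ∀ i s → AllC Special (sticker i s)
    special-sticker = decide (all? λ i → ∀ᵇ? λ s → (_ ≟ᵇ _) ×-dec (_ ≟ᵇ _) ×-dec (_ ≟ᵇ _))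

    special-corner : ∀ i r → AllC Special (cornerSticker i r)
    special-corner = decide (all? λ i → all? λ r → (_ ≟ᵇ _) ×-dec (_ ≟ᵇ _) ×-dec (_ ≟ᵇ _))

  -- Single edges and the induced permutation

  at : Pt n → Fin 12 → Bool → Pt n
  at ρ i s = ⟦ sticker i s ⟧ ρ

  ok-sticker : ∀ ρ i s → AllC (Ok ρ) (sticker i s)
  ok-sticker ρ i s = special⇒ok ρ _ (special-sticker i s)

  edgeIdx-at : ∀ ρ i s → edgeIdx n (at ρ i s) ≡ i
  edgeIdx-at ρ i s = trans (edgeIdx-sound ρ (sticker i s) (ok-sticker ρ i s)) (proj₁ (sticker-idx i s))

  second-at : ∀ ρ i s → second n (at ρ i s) ≡ s
  second-at ρ i s = trans (second-sound ρ (sticker i s) (ok-sticker ρ i s)) (proj₂ (sticker-idx i s))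

  singleEdge-at : ∀ ρ i s → SingleEdge n (at ρ i s)
  singleEdge-at ρ i s = edge⇐ ρ (sticker i s) (ok-sticker ρ i s) (sticker-edge i s)

  -- Matching on this view turns a facelet of a single edge into a symbolic sticker with known
  -- `edgeIdx` and `second`.
  data EdgeView : Pt n → Set where
    edge : ∀ ρ i s → EdgeView (at ρ i s)

  edgeView : ∀ p → SingleEdge n p → EdgeView p
  edgeView p se with pointOf p
  ... | (i , j , k) , eq , ok = subst EdgeView
    (sym (trans eq (cong (⟦_⟧ p) (edge-point i j k shape))))
    (edge p (edgeIdxˢ (point i j k)) (secondˢ (point i j k)))
    where
    shape : T (edgeˢ (point i j k))
    shape = edge⇒ p (point i j k) ok (subst (SingleEdge n) eq se)

  turn-view : ∀ f {p} → EdgeView p → SingleEdge n (turn f p)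
  turn-view f (edge ρ i s) = subst (SingleEdge n) (sym (turn-sound ρ f (sticker i s)))
    (edge⇐ ρ (turnˢ f (sticker i s)) (AllC-turn (Ok-mirror ρ) f (sticker i s) (ok-sticker ρ i s))
      (turn-sticker-edge f i s))

  turn-edge : ∀ f p → SingleEdge n p → SingleEdge n (turn f p)
  turn-edge f p se = turn-view f (edgeView p se)

  -- A move either leaves a facelet in place or carries it as a rotation of the whole cube would,
  -- and such rotations preserve the set of single edges. This covers arbitrary layer numbers, as
  -- `Induces-++` requires.
  move-edge : ∀ m p → SingleEdge n p → SingleEdge n (applyMove n m p)
  move-edge (mv f k cw) p se with inSlice n f k p
  ... | true  = turn-edge f p se
  ... | false = se
  move-edge (mv f k ccw) p se with inSlice n f k p
  ... | true  = turn-edge f _ (turn-edge f _ (turn-edge f p se))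
  ... | false = se

  eval-edge : ∀ w p → SingleEdge n p → SingleEdge n (eval n w p)
  eval-edge []      p se = se
  eval-edge (m ∷ w) p se = move-edge m _ (eval-edge w p se)

  Induces-++ : ∀ w w′ σ τ → Induces n w σ → Induces n w′ τ → Induces n (w ++ w′) (σ ∘ τ)
  Induces-++ w w′ σ τ ind ind′ p se = trans (cong (edgeIdx n) (eval-++ n w w′ p))
    (trans (ind (eval n w′ p) (eval-edge w′ p se)) (cong σ (ind′ p se)))

  eval-at : ∀ w → All (ValidMove n) w → ∀ ρ i s →
    eval n w (at ρ i s) ≡ at ρ (adjs (edgeWords (outerPart w)) ⟨$⟩ʳ i) (s xor flips (outerPart w) i)
  eval-at w vs ρ i s = trans (outerPart-sound ρ w _ vs (special-sticker i s))
    (cong (⟦_⟧ ρ) (run-sticker (outerPart w) i s))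

  Induces-adjs : ∀ w → All (ValidMove n) w → Induces n w (adjs (edgeWords (outerPart w)) ⟨$⟩ʳ_)
  Induces-adjs w vs p se = go (edgeView p se)
    where
    σ : Fin 12 → Fin 12
    σ = adjs (edgeWords (outerPart w)) ⟨$⟩ʳ_
    go : ∀ {p} → EdgeView p → edgeIdx n (eval n w p) ≡ σ (edgeIdx n p)
    go (edge ρ i s) = trans (cong (edgeIdx n) (eval-at w vs ρ i s))
      (trans (edgeIdx-at ρ (σ i) (s xor flips (outerPart w) i)) (cong σ (sym (edgeIdx-at ρ i s))))

  -- Corners and parity

  cornerIdxⁿ : Pt n → Fin 8
  cornerIdxⁿ (pt a b c) = cornerIdx (hi n a) (hi n b) (hi n c)

  cornerIdx-sound : ∀ ρ s → AllC (Ok ρ) s → cornerIdxⁿ (⟦ s ⟧ ρ) ≡ cornerIdxˢ s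
  cornerIdx-sound ρ s (a , b , c)
    rewrite high (agrees ρ _ a) | high (agrees ρ _ b) | high (agrees ρ _ c) = refl

  corners-fixed : ∀ w → All (ValidMove n) w →
    (∀ p → Facelet n p → ¬ SingleEdge n p → eval n w p ≡ p) →
    ∀ i → adjs (cornerWords (outerPart w)) ⟨$⟩ʳ i ≡ i
  corners-fixed w vs fixed i with run-corner (outerPart w) i 0F
  ... | r , eq = begin
    i′                             ≡⟨ idx i′ r ⟨
    cornerIdxⁿ (corner i′ r)       ≡⟨ cong (cornerIdxⁿ ∘ (⟦_⟧ ρ)) eq ⟨
    cornerIdxⁿ (⟦ run (outerPart w) (cornerSticker i 0F) ⟧ ρ)
                                   ≡⟨ cong cornerIdxⁿ (outerPart-sound ρ w _ vs (special-corner i 0F)) ⟨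
    cornerIdxⁿ (eval n w (corner i 0F)) ≡⟨ cong cornerIdxⁿ (fixed _ facelet notEdge) ⟩
    cornerIdxⁿ (corner i 0F)       ≡⟨ idx i 0F ⟩
    i                              ∎
    where
    open ≡-Reasoning
    ρ : Pt n
    -- Corner stickers have only special coordinates, so any valuation serves.
    ρ = pt zero zero zero
    i′ : Fin 8
    i′ = adjs (cornerWords (outerPart w)) ⟨$⟩ʳ i
    corner : Fin 8 → Fin 3 → Pt n
    corner j r = ⟦ cornerSticker j r ⟧ ρ
    ok : ∀ j r → AllC (Ok ρ) (cornerSticker j r)
    ok j r = special⇒ok ρ _ (special-corner j r)
    idx : ∀ j r → cornerIdxⁿ (corner j r) ≡ j
    idx j r = trans (cornerIdx-sound ρ _ (ok j r)) (cornerIdx-sticker j r)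
    facelet : Facelet n (corner i 0F)
    facelet = subst id (sym (facelet-sound ρ (cornerSticker i 0F) (ok i 0F))) (proj₁ (corner-facelet i 0F))
    notEdge : ¬ SingleEdge n (corner i 0F)
    notEdge = proj₂ (corner-facelet i 0F) ∘ edge⇒ ρ (cornerSticker i 0F) (ok i 0F)

  acts-evenly : ∀ ch w → All (ValidMove n) w → InES n ch w →
    Σ (Permutation′ 12) λ σ → Induces n w (σ ⟨$⟩ʳ_) × IsEven σ
  acts-evenly ch w vs (fixed , _) = adjs (edgeWords (outerPart w)) , Induces-adjs w vs ,
    adjs-even (edgeWords (outerPart w)) (trans (edgeWords-cornerWords (outerPart w))
      (adjs-id⇒¬odd (cornerWords (outerPart w)) (corners-fixed w vs fixed)))

  -- Orientation and faithfulness

  xor-solve : ∀ a b {c} → (a xor b) ≡ c → b ≡ (a xor c)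
  xor-solve a b refl = trans (cong (_xor b) (sym (xor-same a))) (xor-assoc a a b)

  -- Orientation 0 in explicit form: the label of a facelet relative to the reference facelet of its
  -- edge, `s xor ch i`, is carried along unchanged.
  Acts : (Fin 12 → Bool) → List Move → (Fin 12 → Fin 12) → Set
  Acts ch w σ = ∀ ρ i s → eval n w (at ρ i s) ≡ at ρ (σ i) (s xor (ch i xor ch (σ i)))

  -- `InES` speaks of the reference facelet; since `flips` is the same for both facelets of an edge,
  -- the image of the other one is determined too.
  inES⇒acts : ∀ ch w σ → All (ValidMove n) w → InES n ch w → Induces n w σ → Acts ch w σ
  inES⇒acts ch w σ vs (_ , oriented) ind ρ i s = trans (eval-at w vs ρ i s)
    (cong₂ (λ j t → at ρ j (s xor t)) σ′i≡σi (xor-solve (ch i) (flips u i) ref))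
    where
    u : List Gen
    u = outerPart w
    σ′ : Fin 12 → Fin 12
    σ′ = adjs (edgeWords u) ⟨$⟩ʳ_
    σ′i≡σi : σ′ i ≡ σ i
    σ′i≡σi = begin
      σ′ i                           ≡⟨ edgeIdx-at ρ (σ′ i) _ ⟨
      edgeIdx n (at ρ (σ′ i) _)      ≡⟨ cong (edgeIdx n) (eval-at w vs ρ i s) ⟨
      edgeIdx n (eval n w (at ρ i s)) ≡⟨ ind _ (singleEdge-at ρ i s) ⟩
      σ (edgeIdx n (at ρ i s))       ≡⟨ cong σ (edgeIdx-at ρ i s) ⟩
      σ i                            ∎
      where open ≡-Reasoning
    image : Pt n
    image = at ρ (σ′ i) (ch i xor flips u i)
    image-ref : IsRef n ch image
    image-ref = subst (IsRef n ch) (eval-at w vs ρ i (ch i))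
      (oriented _ (singleEdge-at ρ i (ch i)) (trans (second-at ρ i (ch i)) (cong ch (sym (edgeIdx-at ρ i (ch i))))))
    ref : (ch i xor flips u i) ≡ ch (σ i)
    ref = trans (sym (second-at ρ (σ′ i) _)) (trans image-ref (cong ch (trans (edgeIdx-at ρ (σ′ i) _) σ′i≡σi)))

  faithful : ∀ ch w w′ σ → All (ValidMove n) w → All (ValidMove n) w′ →
    InES n ch w → InES n ch w′ → Induces n w σ → Induces n w′ σ →
    ∀ p → Facelet n p → eval n w p ≡ eval n w′ p
  faithful ch w w′ σ vs vs′ es es′ ind ind′ p fp = go (T? _ ×-dec T? _)
    where
    onEdge : ∀ {p} → EdgeView p → eval n w p ≡ eval n w′ p
    onEdge (edge ρ i s) = trans (inES⇒acts ch w σ vs es ind ρ i s) (sym (inES⇒acts ch w′ σ vs′ es′ ind′ ρ i s))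
    go : Dec (SingleEdge n p) → eval n w p ≡ eval n w′ p
    go (yes se)  = onEdge (edgeView p se)
    go (no  ¬se) = trans (proj₁ es p fp ¬se) (sym (proj₁ es′ p fp ¬se))

  -- Realising even permutations

  record Realised (ch : Fin 12 → Bool) (σ : Fin 12 → Fin 12) : Set where
    constructor realised
    field
      moves   : List Move
      valid   : All (ValidMove n) moves
      inES    : InES n ch moves
      induces : Induces n moves σ

  realise-id : ∀ {ch} → Realised ch id
  realise-id = realised [] [] ((λ _ _ _ → refl) , (λ _ _ ref → ref)) (λ _ _ → refl)

  realise-∘ : ∀ {ch σ τ} → Realised ch σ → Realised ch τ → Realised ch (σ ∘ τ)
  realise-∘ {ch} {σ} {τ} (realised w vs (fix , ref) ind) (realised w′ vs′ (fix′ , ref′) ind′) =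
    realised (w ++ w′) (++⁺ vs vs′)
    ( (λ p fp ¬se → trans (eval-++ n w w′ p) (trans (cong (eval n w) (fix′ p fp ¬se)) (fix p fp ¬se)))
    , (λ p se r → subst (IsRef n ch) (sym (eval-++ n w w′ p))
        (ref _ (eval-edge w′ p se) (ref′ p se r))))
    (Induces-++ w w′ σ τ ind ind′)

  realise-≗ : ∀ {ch σ τ} → (∀ i → σ i ≡ τ i) → Realised ch σ → Realised ch τ
  realise-≗ eq (realised w vs es ind) = realised w vs es λ p se → trans (ind p se) (eq _)

  acts⇒realised : ∀ ch w σ → All (ValidMove n) w →
    (∀ p → Facelet n p → ¬ SingleEdge n p → eval n w p ≡ p) → Acts ch w σ → Realised ch σ
  acts⇒realised ch w σ vs fix acts = realised w vs (fix , oriented) ind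
    where
    index : ∀ {p} → EdgeView p → edgeIdx n (eval n w p) ≡ σ (edgeIdx n p)
    index (edge ρ i s) = trans (cong (edgeIdx n) (acts ρ i s))
      (trans (edgeIdx-at ρ (σ i) _) (cong σ (sym (edgeIdx-at ρ i s))))
    ind : Induces n w σ
    ind p se = index (edgeView p se)
    keepsRef : ∀ {p} → EdgeView p → IsRef n ch p → IsRef n ch (eval n w p)
    keepsRef (edge ρ i s) ref = begin
      second n (eval n w (at ρ i s))       ≡⟨ cong (second n) (acts ρ i s) ⟩
      second n (at ρ (σ i) t)              ≡⟨ second-at ρ (σ i) t ⟩
      t                                    ≡⟨ cong (_xor (ch i xor ch (σ i))) s≡ch ⟩
      (ch i xor (ch i xor ch (σ i)))       ≡⟨ xor-solve (ch i) (ch (σ i)) refl ⟨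
      ch (σ i)                             ≡⟨ cong ch (edgeIdx-at ρ (σ i) t) ⟨
      ch (edgeIdx n (at ρ (σ i) t))        ≡⟨ cong (ch ∘ edgeIdx n) (acts ρ i s) ⟨
      ch (edgeIdx n (eval n w (at ρ i s))) ∎
      where
      open ≡-Reasoning
      t : Bool
      t = s xor (ch i xor ch (σ i))
      s≡ch : s ≡ ch i
      s≡ch = trans (sym (second-at ρ i s)) (trans ref (cong ch (edgeIdx-at ρ i s)))
    oriented : ∀ p → SingleEdge n p → IsRef n ch p → IsRef n ch (eval n w p)
    oriented p se = keepsRef (edgeView p se)

  module _ (ch : Fin 12 → Bool) (i : Fin 10) where

    -- Chosen so that the offsets on the triple become the reference choice relative to that of the
    -- first edge. This makes the 3-cycle respect the orientations defined by an arbitrary `ch`.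
    twist₁ twist₂ : Bool
    twist₁ = ch (first₃ i) xor ch (second₃ i)
    twist₂ = ch (first₃ i) xor ch (third₃ i)

    offset-ch : ∀ {j} → InTriple i j → offset i twist₁ twist₂ j ≡ (ch (first₃ i) xor ch j)
    offset-ch (inj₁ refl)        = trans (proj₁ (offset-values i twist₁ twist₂)) (sym (xor-same (ch (first₃ i))))
    offset-ch (inj₂ (inj₁ refl)) = proj₁ (proj₂ (offset-values i twist₁ twist₂))
    offset-ch (inj₂ (inj₂ refl)) = proj₂ (proj₂ (offset-values i twist₁ twist₂))

    offset-rot3 : ∀ j → (offset i twist₁ twist₂ j xor offset i twist₁ twist₂ (rot3 i j)) ≡ (ch j xor ch (rot3 i j))
    offset-rot3 j with rot3-support i j
    ... | inj₁ eq = trans (fixed (offset i twist₁ twist₂)) (sym (fixed ch))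
      where
      fixed : ∀ (f : Fin 12 → Bool) → (f j xor f (rot3 i j)) ≡ false
      fixed f = trans (cong (λ k → f j xor f k) eq) (xor-same (f j))
    ... | inj₂ (j∈ , j′∈) = trans (cong₂ _xor_ (offset-ch j∈) (offset-ch j′∈))
      (telescope (ch (first₃ i)) (ch j) (ch (rot3 i j)))
      where
      telescope : ∀ r s t → ((r xor s) xor (r xor t)) ≡ (s xor t)
      telescope false s t = refl
      telescope true  s t = xor-annihilates-not s t

    threeCycle : List Gen
    threeCycle = cycle3 i twist₁ twist₂

    cycle3-fixes-facelet : ∀ p → Facelet n p → ¬ SingleEdge n p → eval n (word threeCycle) p ≡ p
    cycle3-fixes-facelet p fp ¬se = go (pointOf p)
      where
      go : (∃ λ ((j , k , l) : Fin 6 × Fin 6 × Fin 6) → p ≡ ⟦ point j k l ⟧ p × AllC (Ok p) (point j k l)) →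
        eval n (word threeCycle) p ≡ p
      go ((j , k , l) , eq , ok) = begin
        eval n (word threeCycle) p                   ≡⟨ cong (eval n (word threeCycle)) eq ⟩
        eval n (word threeCycle) (⟦ point j k l ⟧ p) ≡⟨ word-sound p threeCycle (point j k l) ok ⟩
        ⟦ run threeCycle (point j k l) ⟧ p           ≡⟨ cong (⟦_⟧ p) (cycle3-fixes i twist₁ twist₂ j k l facelet notEdge) ⟩
        ⟦ point j k l ⟧ p                            ≡⟨ eq ⟨
        p                                            ∎
        where
        open ≡-Reasoning
        facelet : T (faceletˢ (point j k l))
        facelet = subst id (facelet-sound p (point j k l) ok) (subst (Facelet n) eq fp)
        notEdge : ¬ T (edgeˢ (point j k l))
        notEdge t = ¬se (subst (SingleEdge n) (sym eq) (edge⇐ p (point j k l) ok t))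

    cycle3-acts : Acts ch (word threeCycle) (rot3 i)
    cycle3-acts ρ j s = trans (word-sound ρ threeCycle (sticker j s) (ok-sticker ρ j s)) (cong (⟦_⟧ ρ)
      (trans (cycle3-sticker i twist₁ twist₂ j s) (cong (λ t → sticker (rot3 i j) (s xor t)) (offset-rot3 j))))

    realise-rot3 : Realised ch (rot3 i)
    realise-rot3 = acts⇒realised ch (word threeCycle) (rot3 i) (word-valid threeCycle) cycle3-fixes-facelet cycle3-acts

  module _ {ch : Fin 12 → Bool} where

    -- Induction on `i`, starting from the identity at 0: each step multiplies by one 3-cycle, in
    -- which the factor `adj (inject₁ i)` cancels. Both orders are kept because `realise-adj₂` joins
    -- one of each.
    realise-adj₀ : ∀ i → Realised ch (adj i ∘ adj 0F) × Realised ch (adj 0F ∘ adj i)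
    realise-adj₀ = <-weakInduction _ (square , square) λ i (l , r) →
      realise-≗ (λ j → cong (adj (suc i)) (adj-involutive (inject₁ i) _))
        (realise-∘ (realise-≗ (rot3-inverse i) (realise-∘ (realise-rot3 ch i) (realise-rot3 ch i))) l) ,
      realise-≗ (λ j → cong (adj 0F) (adj-involutive (inject₁ i) _)) (realise-∘ r (realise-rot3 ch i))
      where
      square : Realised ch (adj 0F ∘ adj 0F)
      square = realise-≗ (λ j → sym (adj-involutive 0F j)) realise-id

    realise-adj₂ : ∀ i j → Realised ch (adj i ∘ adj j)
    realise-adj₂ i j = realise-≗ (λ k → cong (adj i) (adj-involutive 0F (adj j k)))
      (realise-∘ (proj₁ (realise-adj₀ i)) (proj₂ (realise-adj₀ j)))

    realise-adjs : ∀ u → odd (length u) ≡ false → Realised ch (adjs u ⟨$⟩ʳ_)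
    realise-adjs []          _  = realise-id
    realise-adjs (i ∷ j ∷ u) eq = realise-∘ (realise-adj₂ i j)
      (realise-adjs u (trans (sym (not-involutive _)) eq))

    realise-even : ∀ (σ : Permutation′ 12) → IsEven σ →
      Σ (List Move) λ w → All (ValidMove n) w × InES n ch w × Induces n w (σ ⟨$⟩ʳ_)
    realise-even σ even = moves , valid , inES , induces
      where
      u : List (Fin 11)
      u = proj₁ (adjs-surjective σ)
      eq : ∀ k → adjs u ⟨$⟩ʳ k ≡ σ ⟨$⟩ʳ k
      eq = proj₂ (adjs-surjective σ)
      open Realised (realise-≗ eq (realise-adjs u (even⇒¬odd σ u eq even)))

-- The four clauses say that the action on positions lands in the even permutations, is
-- multiplicative, is injective and is onto; together they give the isomorphism.
theorem11 : (n : ℕ) → 3 ≤ n → n % 2 ≡ 1 → (ch : Fin 12 → Bool) →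
    (∀ w → All (ValidMove n) w → InES n ch w →
    Σ (Permutation′ 12) (λ σ → Induces n w (σ ⟨$⟩ʳ_) × IsEven σ))
    × (∀ w w' σ τ → Induces n w σ → Induces n w' τ → Induces n (w ++ w') (σ ∘ τ))
    × (∀ w w' σ → All (ValidMove n) w → All (ValidMove n) w' →
    InES n ch w → InES n ch w' → Induces n w σ → Induces n w' σ →
    ∀ p → Facelet n p → eval n w p ≡ eval n w' p)
    × (∀ (σ : Permutation′ 12) → IsEven σ →
    Σ (List Move) (λ w → All (ValidMove n) w × InES n ch w × Induces n w (σ ⟨$⟩ʳ_)))
theorem11 n 3≤n n%2≡1 ch = acts-evenly ch , Induces-++ , faithful ch , realise-even {ch}
  where
  open Cube n 3≤n (trans (m≡m%n+[m/n]*n n 2) (cong (_+ n / 2 * 2) n%2≡1))
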